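{- (1) Let $P$ and $Q$ be a permutation well moded (definite) program and a permutation well moded query. If $P$ and $Q$ input terminate, then they $\exists$-terminate. (2) Let $P$ and $Q$ be a permutation well and simply moded program and query, i.e. $P$ and $Q$ are both permutation well moded and permutation simply moded. If $P$ is simply-acceptable by some moded generalised level mapping $|.|$ and some simply-local model $I$ of $P$ containing $\mathit{SM}_P$, then $P$ and $Q$ are (both) fair-bounded by some extended level mapping and some Herbrand interpretation.
   Context: Fix a first-order language $L$ rich enough to contain all symbols of the programs and queries considered; $B_L$ is the Herbrand base (all ground atoms) and $\mathit{Atom}_L$ the set of all atoms. A (definite) program is a finite set of clauses $A\leftarrow B_1,\ldots,B_n$; a query is a finite sequence of atoms. $\mathit{ground}_L(E)$ is the set of ground instances of $E$. A Herbrand interpretation $I$ is a set of ground atoms; $I\models B_1,\ldots,B_n$ iff all $B_i\in I$; $I$ is a model of $P$ if for each $A\leftarrow B_1,\ldots,B_n$ in $\mathit{ground}_L(P)$, $I\models B_1,\ldots,B_n$ implies $A\in I$. For a substitution $\theta$, $\mathit{Dom}(\theta)$ is its domain and $\mathit{Ran}(\theta)$ the set of variables in its range. Modes. Each predicate has a fixed mode, labelling each argument position as input or output; an atom written $p(\mathbf{s},\mathbf{t})$ has the vector $\mathbf{s}$ in its input positions and $\mathbf{t}$ in its output positions. A query $p_1(\mathbf{s}_1,\mathbf{t}_1),\ldots,p_n(\mathbf{s}_n,\mathbf{t}_n)$ is well moded if for all $i\in[1,n]$, $\mathit{Vars}(\mathbf{s}_i)\subseteq\bigcup_{j=1}^{i-1}\mathit{Vars}(\mathbf{t}_j)$.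 A clause $p(\mathbf{t}_0,\mathbf{s}_{n+1})\leftarrow p_1(\mathbf{s}_1,\mathbf{t}_1),\ldots,p_n(\mathbf{s}_n,\mathbf{t}_n)$ is well moded if for all $i\in[1,n+1]$, $\mathit{Vars}(\mathbf{s}_i)\subseteq\bigcup_{j=0}^{i-1}\mathit{Vars}(\mathbf{t}_j)$. This clause is simply moded if $\mathbf{t}_1,\ldots,\mathbf{t}_n$ is a linear vector of variables (pairwise distinct variables) and for all $i\in[1,n]$, $\mathit{Vars}(\mathbf{t}_i)\cap\mathit{Vars}(\mathbf{t}_0)=\emptyset$ and $\mathit{Vars}(\mathbf{t}_i)\cap\bigcup_{j=1}^{i}\mathit{Vars}(\mathbf{s}_j)=\emptyset$. A query $\mathbf{B}$ is simply moded if the clause $q\leftarrow\mathbf{B}$ is, where $q$ is any variable-free atom. A program is well (simply) moded if all its clauses are. A query (clause, program) is permutation well moded if it is well moded modulo reordering of the atoms of the query (of each clause body); it is permutation simply moded if it is simply moded modulo reordering of the atoms of the query (of each clause body). Selection rules. A selection rule is a function on initial fragments of SLD-derivations whose last query is non-empty; it either selects an atom occurrence of the last query together with a set of program clauses that may be used to resolve it, or selects no atom (deadlock; the derivation ends there). A standard selection rule always selects exactly one atom together with all clauses for that atom's predicate. A selection rule $s$ is input-consuming for $P$ if in each case either: $s$ selects an atom $p(\mathbf{s},\mathbf{t})$ and a non-empty set of clauses of $P$ such that $p(\mathbf{s},\mathbf{t})$ and each (renamed apart) head of a clause in the set are unifiable with an mgu $\sigma$ with $\mathit{Dom}(\sigma)\cap\mathit{Vars}(\mathbf{s})=\emptyset$;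 or $s$ selects an atom that unifies with no clause head from $P$, together with all clauses of $P$ (failure); or, if the previous cases are impossible, $s$ selects no atom. $P$ and $Q$ universally terminate w.r.t. a set $\mathcal{S}$ of selection rules if every SLD-derivation of $P$ and $Q$ via any rule in $\mathcal{S}$ is finite. $P$ and $Q$ input terminate if they universally terminate w.r.t. the set of input-consuming selection rules. $P$ and $Q$ $\exists$-terminate if there is a non-empty set $\mathcal{S}$ of standard selection rules such that $P$ and $Q$ universally terminate w.r.t. $\mathcal{S}$. Simply-local substitutions and models. A substitution $\theta$ is simply-local w.r.t. a clause $c=p(\mathbf{t}_0,\mathbf{s}_{n+1})\leftarrow p_1(\mathbf{s}_1,\mathbf{t}_1),\ldots,p_n(\mathbf{s}_n,\mathbf{t}_n)$ if there are substitutions $\sigma_0,\ldots,\sigma_n$ and disjoint sets $v_0,\ldots,v_n$ of variables fresh w.r.t. $c$ such that $\theta=\sigma_0\sigma_1\cdots\sigma_n$ and for $i\in\{0,\ldots,n\}$: $\mathit{Dom}(\sigma_i)\subseteq\mathit{Vars}(\mathbf{t}_i)$ and $\mathit{Ran}(\sigma_i)\subseteq\mathit{Vars}(\mathbf{s}_i\sigma_0\sigma_1\cdots\sigma_{i-1})\cup v_i$ (where for $i=0$ the set $\mathit{Vars}(\mathbf{s}_0\cdots)$ is taken to be empty). A set $I\subseteq\mathit{Atom}_L$ is a simply-local model of a clause $c=H\leftarrow B_1,\ldots,B_n$ if for every $\theta$ simply-local w.r.t. $c$: $B_1\theta,\ldots,B_n\theta\in I$ implies $H\theta\in I$; it is a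 simply-local model of $P$ if it is one of each clause of $P$. $\mathit{SM}_P$ is the set of all simply moded atoms in $\mathit{Atom}_L$ (atoms that, as one-atom queries, are simply moded). Simply-acceptable. A moded generalised level mapping is a function $|.|$ from atoms modulo variance (renaming of variables) to $\mathbb{N}$ with $|p(\mathbf{s},\mathbf{t})|=|p(\mathbf{s},\mathbf{u})|$ for all (not necessarily ground) $\mathbf{s},\mathbf{t},\mathbf{u}$. Write $A\simeq B$ if the predicates of $A$ and $B$ are mutually recursive in $P$ (each depends on the other, where "depends on" is the reflexive transitive closure of the relation "$p$ is the head predicate of a clause of $P$ having $q$ in its body"). Given a moded generalised level mapping $|.|$ and a simply-local model $I$ of $P$ containing $\mathit{SM}_P$, $P$ is simply-acceptable by $|.|$ and $I$ if for every clause $A\leftarrow B_1,\ldots,B_n$ of $P$, every substitution $\theta$ simply-local w.r.t. it, and all $i\in[1,n]$: $B_1\theta,\ldots,B_{i-1}\theta\in I$ and $A\simeq B_i$ imply $|A\theta|>|B_i\theta|$. Fair-bounded. An extended level mapping is a function $|.|:B_L\to\mathbb{N}^\infty=\mathbb{N}\cup\{\infty\}$; $n\rhd m$ for $n,m\in\mathbb{N}^\infty$ iff $n=\infty$ or $n>m$. $P$ is fair-bounded by an extended level mapping $|.|$ and a Herbrand interpretation $I$ if $I$ is a model of $P$ such that for every $A\leftarrow B_1,\ldots,B_n$ in $\mathit{ground}_L(P)$: (a) $I\models B_1,\ldots,B_n$ implies that for every $i\in[1,n]$, $|A|\rhd|B_i|$; and (b) $I\not\models B_1,\ldots,B_n$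 implies that there exists $i\in[1,n]$ with $I\not\models B_i$ and $|A|\rhd|B_i|$. $Q$ is fair-bounded by $|.|$ and $I$ if there is $k\in\mathbb{N}$ such that for every $A_1,\ldots,A_n\in\mathit{ground}_L(Q)$: (a) $I\models A_1,\ldots,A_n$ implies that for every $i\in[1,n]$, $k\rhd|A_i|$; and (b) $I\not\models A_1,\ldots,A_n$ implies that there exists $i\in[1,n]$ with $I\not\models A_i$ and $k\rhd|A_i|$. -}

module Defs where

open import Level using (0ℓ)
open import Data.Fin using (Fin; toℕ)
open import Data.List using (List; []; _∷_; _++_; map; concatMap; length; lookup; take; drop)
open import Data.List.Membership.Propositional using (_∈_; _∉_)
open import Data.List.Relation.Binary.Disjoint.Propositional using (Disjoint)
open import Data.List.Relation.Binary.Permutation.Propositional using (_↭_)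
open import Data.List.Relation.Binary.Subset.Propositional using (_⊆_)
open import Data.List.Relation.Unary.All using (All)
open import Data.List.Relation.Unary.Any using (Any)
open import Data.List.Relation.Unary.Unique.Propositional using (Unique)
open import Data.Maybe using (Maybe; just; nothing)
open import Data.Nat using (ℕ; _≤_; _<_; _⊔_) renaming (suc to 1+)
open import Data.Nat.Properties using (≤-trans; m≤m⊔n; m≤n⊔m)
open import Data.Product using (Σ-syntax; ∃-syntax; ∃₂; _×_; _,_; proj₁; proj₂)
open import Data.Sum using (_⊎_)
open import Data.Vec using (Vec; []; _∷_)
open import Function.Bundles using (_⇔_; _↔_; Inverse)
open import Relation.Binary.Construct.Add.Supremum.Strict (_<_) using (_<⁺_)
open import Relation.Binary.Construct.Closure.ReflexiveTransitive using (Star)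
open import Relation.Binary.PropositionalEquality using (_≡_; _≢_; refl; trans; cong)
open import Relation.Nullary using (¬_)
open import Relation.Nullary.Construct.Add.Supremum using (_⁺; ⊤⁺; [_])
open import Relation.Unary using (Pred)

record Language : Set₁ where
  field
    Fun       : Set
    funArity  : Fun → ℕ
    Rel       : Set
    relArity  : Rel → ℕ

data Mode : Set where
  input output : Mode

Moding : Language → Set
Moding L = (p : Language.Rel L) → Vec Mode (Language.relArity L p)

Var : Set
Var = ℕ

module Programs (L : Language) (mode : Moding L) where

  open Language L

  data Term : Set where
    var : Var → Term
    fun : (f : Fun) → Vec Term (funArity f) → Term

  record Atom : Set where
    constructor atom
    field
      rel  : Rel
      args : Vec Term (relArity rel)
  open Atom public

  Query : Set
  Query = List Atom

  record Clause : Set where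
    constructor _⟵_
    field
      head : Atom
      body : Query
  open Clause public

  Program : Set
  Program = List Clause

  mutual
    varsTerm : Term → List Var
    varsTerm (var x)    = x ∷ []
    varsTerm (fun f ts) = varsVec ts

    varsVec : ∀ {n} → Vec Term n → List Var
    varsVec []       = []
    varsVec (t ∷ ts) = varsTerm t ++ varsVec ts

  varsList : List Term → List Var
  varsList = concatMap varsTerm

  varsAtom : Atom → List Var
  varsAtom A = varsVec (args A)

  varsQuery : Query → List Var
  varsQuery = concatMap varsAtom

  varsClause : Clause → List Var
  varsClause c = varsAtom (head c) ++ varsQuery (body c)

  select : Mode → ∀ {n} → Vec Mode n → Vec Term n → List Term
  select m      []            []       = []
  select input  (input  ∷ ms) (t ∷ ts) = t ∷ select input ms ts
  select input  (output ∷ ms) (t ∷ ts) = select input ms ts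
  select output (input  ∷ ms) (t ∷ ts) = select output ms ts
  select output (output ∷ ms) (t ∷ ts) = t ∷ select output ms ts

  inputs outputs : Atom → List Term
  inputs  A = select input  (mode (rel A)) (args A)
  outputs A = select output (mode (rel A)) (args A)

  inVars outVars : Atom → List Var
  inVars  A = varsList (inputs A)
  outVars A = varsList (outputs A)

  -- As usual in logic programming, substitutions have finite domain.
  record Subst : Set where
    constructor mkSubst
    field
      at     : Var → Term
      finite : ∃[ n ] (∀ x → n ≤ x → at x ≡ var x)
  open Subst public

  mutual
    _·ₜ_ : Term → Subst → Term
    var x    ·ₜ σ = at σ x
    fun f ts ·ₜ σ = fun f (ts ·ᵥ σ)

    _·ᵥ_ : ∀ {n} → Vec Term n → Subst → Vec Term n
    []       ·ᵥ σ = []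
    (t ∷ ts) ·ᵥ σ = (t ·ₜ σ) ∷ (ts ·ᵥ σ)

  _·_ : Atom → Subst → Atom
  A · σ = atom (rel A) (args A ·ᵥ σ)

  _·q_ : Query → Subst → Query
  B ·q σ = map (_· σ) B

  _·c_ : Clause → Subst → Clause
  c ·c σ = (head c · σ) ⟵ (body c ·q σ)

  ε : Subst
  ε = mkSubst var (0 , λ _ _ → refl)

  -- Diagrammatic order: t (σ ⨾ τ) = (t σ) τ.
  _⨾_ : Subst → Subst → Subst
  σ ⨾ τ = mkSubst (λ x → at σ x ·ₜ τ)
    (proj₁ (finite σ) ⊔ proj₁ (finite τ) , λ x n≤x →
      trans (cong (_·ₜ τ)
              (proj₂ (finite σ) x (≤-trans (m≤m⊔n (proj₁ (finite σ)) (proj₁ (finite τ))) n≤x)))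
            (proj₂ (finite τ) x (≤-trans (m≤n⊔m (proj₁ (finite σ)) (proj₁ (finite τ))) n≤x)))

  _≐_ : Subst → Subst → Set
  σ ≐ τ = ∀ x → at σ x ≡ at τ x

  Dom : Subst → Pred Var 0ℓ
  Dom σ x = at σ x ≢ var x

  Ran : Subst → Pred Var 0ℓ
  Ran σ y = ∃[ x ] (Dom σ x × y ∈ varsTerm (at σ x))

  IsRenaming : Subst → Set
  IsRenaming ρ = Σ[ π ∈ Var ↔ Var ] (∀ x → at ρ x ≡ var (Inverse.to π x))

  Variant : Atom → Atom → Set
  Variant A B = ∃[ ρ ] (IsRenaming ρ × B ≡ A · ρ)

  ClauseVariant : Clause → Clause → Set
  ClauseVariant c d = ∃[ ρ ] (IsRenaming ρ × d ≡ c ·c ρ)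

  Unifier : Subst → Atom → Atom → Set
  Unifier σ A B = A · σ ≡ B · σ

  IsMgu : Subst → Atom → Atom → Set
  IsMgu σ A B = Unifier σ A B × (∀ τ → Unifier τ A B → ∃[ γ ] (τ ≐ (σ ⨾ γ)))

  -- Below, V stands for Vars(𝐭₀), the variables in the head's input positions.
  -- A query is treated as the body of q ⟵ 𝐁 with q variable-free, so V is
  -- empty; this avoids requiring L to have a variable-free atom.

  WellModedBody : List Var → Query → Set
  WellModedBody V Bs = (i : Fin (length Bs)) →
    inVars (lookup Bs i) ⊆ V ++ concatMap outVars (take (toℕ i) Bs)

  SimplyModedBody : List Var → Query → Set
  SimplyModedBody V Bs =
    (∃[ xs ] (concatMap outputs Bs ≡ map var xs × Unique xs)) ×
    ((i : Fin (length Bs)) →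
       Disjoint (outVars (lookup Bs i)) V ×
       Disjoint (outVars (lookup Bs i)) (concatMap inVars (take (1+ (toℕ i)) Bs)))

  WellModedQuery SimplyModedQuery : Query → Set
  WellModedQuery   = WellModedBody []
  SimplyModedQuery = SimplyModedBody []

  WellModedClause SimplyModedClause : Clause → Set
  WellModedClause c =
    WellModedBody (inVars (head c)) (body c) ×
    outVars (head c) ⊆ inVars (head c) ++ concatMap outVars (body c)
  SimplyModedClause c = SimplyModedBody (inVars (head c)) (body c)

  PermutationQuery : (Query → Set) → Query → Set
  PermutationQuery M Q = ∃[ Q′ ] (Q ↭ Q′ × M Q′)

  PermutationClause : (Clause → Set) → Clause → Set
  PermutationClause M c = ∃[ Bs ] (body c ↭ Bs × M (head c ⟵ Bs))

  PermutationWellModedQuery PermutationSimplyModedQuery : Query → Set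
  PermutationWellModedQuery   = PermutationQuery WellModedQuery
  PermutationSimplyModedQuery = PermutationQuery SimplyModedQuery

  PermutationWellModed PermutationSimplyModed : Program → Set
  PermutationWellModed   = All (PermutationClause WellModedClause)
  PermutationSimplyModed = All (PermutationClause SimplyModedClause)

  data Fragment (P : Program) : Set
  record Step {P : Program} (D : Fragment P) : Set
  lastQuery : ∀ {P} → Fragment P → Query
  Occurs : ∀ {P} → Fragment P → Pred Var 0ℓ

  RenamedApart : ∀ {P} → Fragment P → Clause → Clause → Set
  RenamedApart D c c′ = ClauseVariant c c′ × (∀ x → x ∈ varsClause c′ → ¬ Occurs D x)

  -- Initial fragments of SLD-derivations of P, from any query and with arbitrary mgus.
  data Fragment P where
    start  : Query → Fragment P
    extend : (D : Fragment P) → Step D → Fragment P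

  record Step {P} D where
    inductive
    field
      position  : Fin (length (lastQuery D))
      clause    : Clause
      clause∈P  : clause ∈ P
      variant   : Clause
      apart     : RenamedApart D clause variant
      mgu       : Subst
      isMgu     : IsMgu mgu (lookup (lastQuery D) position) (head variant)

  lastQuery (start Q)    = Q
  lastQuery (extend D s) =
    (take (toℕ (Step.position s)) (lastQuery D)
      ++ body (Step.variant s)
      ++ drop (1+ (toℕ (Step.position s))) (lastQuery D))
    ·q Step.mgu s

  -- The variables used so far: in the first query, the clause variants and the mgus.
  Occurs (start Q)    x = x ∈ varsQuery Q
  Occurs (extend D s) x =
    Occurs D x ⊎ x ∈ varsClause (Step.variant s) ⊎ Dom (Step.mgu s) x ⊎ Ran (Step.mgu s) x

  -- Finite sets of clauses are represented by lists. When the last query is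
  -- empty the only possible value is nothing.
  Selection : ∀ {P} → Fragment P → Set
  Selection D = Fin (length (lastQuery D)) × List Clause

  SelectionRule : Program → Set
  SelectionRule P = (D : Fragment P) → Maybe (Selection D)

  Standard : ∀ {P} → SelectionRule P → Set
  Standard {P} s = ∀ D → lastQuery D ≢ [] →
    ∃₂ λ i cs → s D ≡ just (i , cs) ×
      (∀ c → c ∈ cs ⇔ (c ∈ P × rel (head c) ≡ rel (lookup (lastQuery D) i)))

  -- Selection of an atom p(𝐬,𝐭) and of clauses whose heads, renamed apart from the
  -- fragment, unify with it by an mgu that does not bind Vars(𝐬). The choice of the
  -- renaming is immaterial.
  Resolving : ∀ {P} (D : Fragment P) → Selection D → Set
  Resolving {P} D (i , cs) =
    cs ≢ [] × cs ⊆ P ×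
    (∀ c → c ∈ cs → ∃₂ λ c′ σ →
       RenamedApart D c c′ × IsMgu σ A (head c′) × (∀ x → Dom σ x → x ∉ inVars A))
    where A = lookup (lastQuery D) i

  Failing : ∀ {P} (D : Fragment P) → Selection D → Set
  Failing {P} D (i , cs) =
    (∀ c c′ σ → c ∈ P → RenamedApart D c c′ → ¬ Unifier σ (lookup (lastQuery D) i) (head c′)) ×
    (∀ c → c ∈ cs ⇔ c ∈ P)

  InputConsuming : ∀ {P} → SelectionRule P → Set
  InputConsuming s = ∀ D → lastQuery D ≢ [] →
    (∃[ S ] (s D ≡ just S × Resolving D S)) ⊎
    (∃[ S ] (s D ≡ just S × Failing D S)) ⊎
    (s D ≡ nothing × (∀ S → ¬ Resolving D S × ¬ Failing D S))

  Via : ∀ {P} → SelectionRule P → (D : Fragment P) → Step D → Set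
  Via s D st = ∃[ cs ] (s D ≡ just (Step.position st , cs) × Step.clause st ∈ cs)

  -- An infinite derivation, given as the sequence of its initial fragments.
  record InfiniteDerivation (P : Program) (Q : Query) (s : SelectionRule P) : Set where
    field
      fragment : ℕ → Fragment P
      starts   : fragment 0 ≡ start Q
      step     : ∀ n → Step (fragment n)
      extends  : ∀ n → fragment (1+ n) ≡ extend (fragment n) (step n)
      via      : ∀ n → Via s (fragment n) (step n)

  UniversallyTerminate : (P : Program) → Query → Pred (SelectionRule P) 0ℓ → Set
  UniversallyTerminate P Q S = ∀ s → S s → ¬ InfiniteDerivation P Q s

  InputTerminate : Program → Query → Set
  InputTerminate P Q = UniversallyTerminate P Q InputConsuming

  ∃-Terminate : Program → Query → Set₁
  ∃-Terminate P Q = Σ[ S ∈ Pred (SelectionRule P) 0ℓ ]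
    ((∃[ s ] S s) × (∀ s → S s → Standard s) × UniversallyTerminate P Q S)

  -- compose σ k = σ₀ σ₁ ⋯ σₖ₋₁
  compose : (ℕ → Subst) → ℕ → Subst
  compose σ 0      = ε
  compose σ (1+ k) = compose σ k ⨾ σ k

  -- With body B₁,…,Bₙ, the atom Bᵢ is lookup (body c) at index i − 1. Only the
  -- values σ k and v k for k ≤ n matter.
  SimplyLocal : Clause → Subst → Set₁
  SimplyLocal c θ =
    Σ[ σ ∈ (ℕ → Subst) ] Σ[ v ∈ (ℕ → Pred Var 0ℓ) ]
      (∀ j k → j ≤ n → k ≤ n → j ≢ k → ∀ x → ¬ (v j x × v k x)) ×
      (∀ k → k ≤ n → ∀ x → v k x → x ∉ varsClause c) ×
      θ ≐ compose σ (1+ n) ×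
      (∀ x → Dom (σ 0) x → x ∈ inVars (head c)) ×
      (∀ x → Ran (σ 0) x → v 0 x) ×
      ((i : Fin n) →
         let B = lookup (body c) i; k = 1+ (toℕ i) in
         (∀ x → Dom (σ k) x → x ∈ outVars B) ×
         (∀ x → Ran (σ k) x → x ∈ inVars (B · compose σ k) ⊎ v k x))
    where n = length (body c)

  SimplyLocalModel : Pred Atom 0ℓ → Program → Set₁
  SimplyLocalModel I P = ∀ c → c ∈ P → ∀ θ → SimplyLocal c θ →
    All I (body c ·q θ) → I (head c · θ)

  SM : Pred Atom 0ℓ
  SM A = SimplyModedQuery (A ∷ [])

  record ModedGeneralisedLevelMapping : Set where
    field
      level   : Atom → ℕ
      variant : ∀ A B → Variant A B → level A ≡ level B
      moded   : ∀ p (ts us : Vec Term (relArity p)) →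
                inputs (atom p ts) ≡ inputs (atom p us) →
                level (atom p ts) ≡ level (atom p us)

  Refers : Program → Rel → Rel → Set
  Refers P p q = ∃[ c ] (c ∈ P × rel (head c) ≡ p × ∃[ B ] (B ∈ body c × rel B ≡ q))

  DependsOn : Program → Rel → Rel → Set
  DependsOn P = Star (Refers P)

  MutuallyRecursive : Program → Atom → Atom → Set
  MutuallyRecursive P A B = DependsOn P (rel A) (rel B) × DependsOn P (rel B) (rel A)

  record SimplyAcceptable (P : Program) (ℓ : ModedGeneralisedLevelMapping)
                          (I : Pred Atom 0ℓ) : Set₁ where
    open ModedGeneralisedLevelMapping ℓ
    field
      model      : SimplyLocalModel I P
      containsSM : ∀ A → SM A → I A
      decreases  : ∀ c → c ∈ P → ∀ θ → SimplyLocal c θ → (i : Fin (length (body c))) →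
                   All I (take (toℕ i) (body c) ·q θ) →
                   MutuallyRecursive P (head c) (lookup (body c) i) →
                   level (lookup (body c) i · θ) < level (head c · θ)

  HerbrandBase : Set
  HerbrandBase = Σ[ A ∈ Atom ] varsAtom A ≡ []

  HerbrandInterpretation : Set₁
  HerbrandInterpretation = Pred HerbrandBase 0ℓ

  IsGroundInstance : Query → List HerbrandBase → Set
  IsGroundInstance Q As = ∃[ θ ] (map proj₁ As ≡ Q ·q θ)

  IsGroundClause : Program → HerbrandBase → List HerbrandBase → Set
  IsGroundClause P A Bs = ∃[ c ] (c ∈ P ×
    ∃[ θ ] (proj₁ A ≡ head c · θ × map proj₁ Bs ≡ body c ·q θ))

  IsModel : HerbrandInterpretation → Program → Set
  IsModel I P = ∀ A Bs → IsGroundClause P A Bs → All I Bs → I A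

  -- ℕ ⁺ is ℕ ∪ {∞}, with ∞ written ⊤⁺.
  _▷_ : ℕ ⁺ → ℕ ⁺ → Set
  n ▷ m = n ≡ ⊤⁺ ⊎ m <⁺ n

  ExtendedLevelMapping : Set
  ExtendedLevelMapping = HerbrandBase → ℕ ⁺

  Bounds : ExtendedLevelMapping → HerbrandInterpretation → ℕ ⁺ → List HerbrandBase → Set
  Bounds lvl I b Bs =
    (All I Bs → All (λ B → b ▷ lvl B) Bs) ×
    (¬ All I Bs → Any (λ B → ¬ I B × b ▷ lvl B) Bs)

  FairBounded : Program → ExtendedLevelMapping → HerbrandInterpretation → Set
  FairBounded P lvl I =
    IsModel I P × (∀ A Bs → IsGroundClause P A Bs → Bounds lvl I (lvl A) Bs)

  FairBoundedQuery : Query → ExtendedLevelMapping → HerbrandInterpretation → Set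
  FairBoundedQuery Q lvl I =
    ∃[ k ] (∀ As → IsGroundInstance Q As → Bounds lvl I [ k ] As)

-- (1) In a non-empty permutation well moded query some atom has ground inputs, and permutation
-- well modedness is inherited by resolvents. Selecting such an atom is input-consuming, because no
-- mgu binds a variable of its inputs; so an infinite derivation via the standard rule selecting
-- these atoms is also one via an input-consuming rule.
--
-- (2) P is fair-bounded by its least Herbrand model and the least level mapping satisfying the
-- clause conditions with that model, so everything is in the bound for Q. By induction on
-- (dependency of the predicate, moded level), the ground atoms p(𝐬,𝐭) with fixed 𝐬 have bounded
-- levels and finitely many successes: in a well moded order the inputs of a body atom are fixed by
-- the answers to its predecessors, of which there are finitely many.
module Submission where

open import Defs
open import Axiom.ExcludedMiddle using (ExcludedMiddle)
open import Data.Empty using (⊥; ⊥-elim)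
open import Data.Fin using (Fin; zero; suc; toℕ)
open import Data.List using (List; []; _∷_; _++_; map; concatMap; length; lookup; take; drop; filter)
open import Data.List.Membership.Propositional using (_∈_; _∉_; find)
open import Data.List.Membership.Propositional.Properties
  using (∈-++⁺ˡ; ∈-++⁺ʳ; ∈-++⁻; ∈-∃++; ∈-concatMap⁺; ∈-concatMap⁻; ∈-filter⁺; ∈-filter⁻)
import Data.List.Membership.DecPropositional as DecMembership
open import Data.List.Properties using (++-assoc; ++-identityʳ; concatMap-++; map-++; ∷-injective)
open import Data.List.Relation.Binary.Disjoint.Propositional using (Disjoint)
open import Data.List.Relation.Binary.Permutation.Propositional
  using (_↭_; ↭-sym; ↭-trans; ↭⇒↭ₛ)
open import Data.List.Relation.Binary.Permutation.Propositional.Properties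
  using (∈-resp-↭; All-resp-↭; Any-resp-↭; drop-mid; shifts)
  renaming (map⁺ to ↭-map⁺; ++⁺ to ↭-++⁺)
open import Data.List.Relation.Binary.Permutation.Setoid.Properties using (AllPairs-resp-↭)
open import Data.List.Relation.Binary.Subset.Propositional using (_⊆_)
open import Data.List.Relation.Binary.Subset.Propositional.Properties
  using (⊆-refl; ⊆-trans; ⊆-reflexive; ⊆-reflexive-↭; ⊆[]⇒≡[]; concatMap⁺; Any-resp-⊆; xs⊆xs++ys; xs⊆ys++xs; ++⁺ʳ)
  renaming (++⁺ to ⊆-++⁺; ++⁺ˡ to ⊆-++⁺ˡ)
open import Data.List.Relation.Unary.All as All using (All; []; _∷_)
import Data.List.Relation.Unary.All.Properties as All
open import Data.List.Relation.Unary.AllPairs using (AllPairs; []; _∷_)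
open import Data.List.Relation.Unary.Any as Any using (Any; here; there; index)
import Data.List.Relation.Unary.Any.Properties as Any
open import Data.List.Relation.Unary.Unique.Propositional using (Unique)
open import Data.Maybe as Maybe using (Maybe; just; nothing)
open import Data.Nat using (ℕ; zero; suc; _≤_; _<_; _⊔_; z≤n; s≤s; _≟_)
open import Data.Nat.Induction using (<-wellFounded)
open import Data.Nat.Properties
  using (≤-antisym; m≤n⇒m≤1+n; m≤m⊔n; m≤n⊔m; ≰⇒>; m<1+n⇒m<n∨m≡n)
open import Data.Product using (∃-syntax; ∃₂; _×_; _,_; proj₁; proj₂)
open import Data.Product.Relation.Binary.Lex.Strict using (×-Lex; ×-wellFounded)
open import Data.Sum using (_⊎_; inj₁; inj₂; [_,_]′)
open import Data.Unit using (⊤; tt)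
open import Data.Vec using (Vec; []; _∷_)
open import Function using (_∘_; _on_; _⇔_; mk⇔)
open import Induction.WellFounded as WF using (WellFounded)
open import Level using (0ℓ)
open import Relation.Binary.Construct.Add.Supremum.Strict (_<_) using ([_])
open import Relation.Binary.Construct.Closure.ReflexiveTransitive using (_◅_; _◅◅_) renaming (ε to εˢ)
import Relation.Binary.Construct.On as On
open import Relation.Binary.PropositionalEquality
  using (_≡_; _≢_; refl; sym; trans; cong; cong₂; subst; setoid; resp₂)
open import Relation.Nullary using (¬_; Dec; yes; no; contradiction)
open import Relation.Nullary.Construct.Add.Supremum using (_⁺; ⊤⁺; [_])
open import Relation.Unary using (Pred)

open DecMembership _≟_ using (_∈?_)

-- Lists: inclusion, splitting, pairwise relations, counting.

⊆-++-elim : ∀ {A : Set} {xs ys zs : List A} → xs ⊆ zs → ys ⊆ zs → xs ++ ys ⊆ zs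
⊆-++-elim {xs = xs} xs⊆ ys⊆ = [ xs⊆ , ys⊆ ]′ ∘ ∈-++⁻ xs

∈⇒⊆concatMap : ∀ {A B : Set} (f : A → List B) {x xs} → x ∈ xs → f x ⊆ concatMap f xs
∈⇒⊆concatMap f x∈xs y∈fx = ∈-concatMap⁺ f (Any.map (λ { refl → y∈fx }) x∈xs)

lookup-split : ∀ {A : Set} (xs : List A) (i : Fin (length xs)) →
  xs ≡ take (toℕ i) xs ++ lookup xs i ∷ drop (suc (toℕ i)) xs
lookup-split (x ∷ xs) zero    = refl
lookup-split (x ∷ xs) (suc i) = cong (x ∷_) (lookup-split xs i)

take⊆ : ∀ {A : Set} n (xs : List A) → take n xs ⊆ xs
take⊆ (suc n) (x ∷ xs) (here eq)  = here eq
take⊆ (suc n) (x ∷ xs) (there y∈) = there (take⊆ n xs y∈)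

++≡map⁻ : ∀ {A B : Set} {f : A → B} as {bs} xs → as ++ bs ≡ map f xs →
  ∃₂ λ ys zs → xs ≡ ys ++ zs × as ≡ map f ys × bs ≡ map f zs
++≡map⁻ []       xs       eq = [] , xs , refl , refl , eq
++≡map⁻ (a ∷ as) (x ∷ xs) eq
  with refl , eq′ ← ∷-injective eq
  with ys , zs , refl , refl , refl ← ++≡map⁻ as xs eq′ = x ∷ ys , zs , refl , refl , refl

module _ {A : Set} {R : A → A → Set} where

  AllPairs-++⁻ˡ : ∀ xs {ys} → AllPairs R (xs ++ ys) → AllPairs R xs
  AllPairs-++⁻ˡ []       _          = []
  AllPairs-++⁻ˡ (x ∷ xs) (px ∷ pxs) = All.++⁻ˡ xs px ∷ AllPairs-++⁻ˡ xs pxs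

  AllPairs-++⁻ʳ : ∀ xs {ys} → AllPairs R (xs ++ ys) → AllPairs R ys
  AllPairs-++⁻ʳ []       pys       = pys
  AllPairs-++⁻ʳ (x ∷ xs) (_ ∷ pxs) = AllPairs-++⁻ʳ xs pxs

  AllPairs-++⁻-cross : ∀ xs {ys} → AllPairs R (xs ++ ys) → ∀ {x y} → x ∈ xs → y ∈ ys → R x y
  AllPairs-++⁻-cross (x ∷ xs) (px ∷ _)  (here refl) y∈ = All.lookup (All.++⁻ʳ xs px) y∈
  AllPairs-++⁻-cross (x ∷ xs) (_ ∷ pxs) (there x∈)  y∈ = AllPairs-++⁻-cross xs pxs x∈ y∈

module _ {A : Set} {P Q : Pred A 0ℓ} (P? : ∀ x → Dec (P x)) (Q? : ∀ x → Dec (Q x))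
         (P⇒Q : ∀ {x} → P x → Q x) where

  filter-length-≤ : ∀ xs → length (filter P? xs) ≤ length (filter Q? xs)
  filter-length-≤ [] = z≤n
  filter-length-≤ (x ∷ xs) with P? x | Q? x
  ... | yes p | yes q = s≤s (filter-length-≤ xs)
  ... | yes p | no ¬q = contradiction (P⇒Q p) ¬q
  ... | no ¬p | yes q = m≤n⇒m≤1+n (filter-length-≤ xs)
  ... | no ¬p | no ¬q = filter-length-≤ xs

  -- The element `x` is kept by the weaker filter and dropped by the stronger one.
  filter-length-< : ∀ {x xs} → x ∈ xs → Q x → ¬ P x → length (filter P? xs) < length (filter Q? xs)
  filter-length-< {xs = x ∷ xs} (here refl) q ¬p with P? x | Q? x
  ... | yes p  | _     = contradiction p ¬p
  ... | no _   | no ¬q = contradiction q ¬q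
  ... | no _   | yes _ = s≤s (filter-length-≤ xs)
  filter-length-< {xs = x ∷ xs} (there x∈) q ¬p with P? x | Q? x
  ... | yes p′ | yes q′ = s≤s (filter-length-< x∈ q ¬p)
  ... | yes p′ | no ¬q′ = contradiction (P⇒Q p′) ¬q′
  ... | no ¬p′ | yes q′ = m≤n⇒m≤1+n (filter-length-< x∈ q ¬p)
  ... | no ¬p′ | no ¬q′ = filter-length-< x∈ q ¬p

-- Finitely many bounds merge into one: the maximum of the numbers and the concatenation of the
-- lists. Monotonicity of `X` in both keeps each individual bound valid.
gather : ∀ {A R : Set} (X : A → ℕ → List R → Set) →
  (∀ {a k k′ Θ Θ′} → k ≤ k′ → Θ ⊆ Θ′ → X a k Θ → X a k′ Θ′) →
  (∀ a → ∃₂ (X a)) → ∀ as → ∃₂ λ k Θ → ∀ {a} → a ∈ as → X a k Θ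
gather X mono x []       = 0 , [] , λ ()
gather X mono x (a ∷ as) with k , Θ , xa ← x a | m , Ξ , xas ← gather X mono x as =
  k ⊔ m , Θ ++ Ξ ,
  λ { (here refl) → mono (m≤m⊔n k m) (xs⊆xs++ys Θ Ξ) xa
    ; (there b∈)  → mono (m≤n⊔m k m) (xs⊆ys++xs Ξ Θ) (xas b∈) }

-- Substitutions, variables and modes.

module Substitution (L : Language) (mode : Moding L) where
  open Programs L mode

  -- A record rather than a bare function type, so that `V`, `θ` and `φ` can be inferred from a
  -- proof.
  record AgreeOn (V : List Var) (θ φ : Subst) : Set where
    constructor agree
    field agrees : ∀ {x} → x ∈ V → at θ x ≡ at φ x
  open AgreeOn public

  agree-refl : ∀ {V θ} → AgreeOn V θ θ
  agree-refl = agree λ _ → refl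

  agree-sym : ∀ {V θ φ} → AgreeOn V θ φ → AgreeOn V φ θ
  agree-sym θ≈φ = agree λ x∈ → sym (agrees θ≈φ x∈)

  agree-trans : ∀ {V θ φ ψ} → AgreeOn V θ φ → AgreeOn V φ ψ → AgreeOn V θ ψ
  agree-trans θ≈φ φ≈ψ = agree λ x∈ → trans (agrees θ≈φ x∈) (agrees φ≈ψ x∈)

  agree-⊆ : ∀ {V W θ φ} → V ⊆ W → AgreeOn W θ φ → AgreeOn V θ φ
  agree-⊆ V⊆W θ≈φ = agree λ x∈ → agrees θ≈φ (V⊆W x∈)

  agree-++ : ∀ {V W θ φ} → AgreeOn V θ φ → AgreeOn W θ φ → AgreeOn (V ++ W) θ φ
  agree-++ {V} v w = agree λ x∈ → [ agrees v , agrees w ]′ (∈-++⁻ V x∈)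

  mutual
    ·ₜ-cong : ∀ t {θ φ} → AgreeOn (varsTerm t) θ φ → t ·ₜ θ ≡ t ·ₜ φ
    ·ₜ-cong (var x)    θ≈φ = agrees θ≈φ (here refl)
    ·ₜ-cong (fun f ts) θ≈φ = cong (fun f) (·ᵥ-cong ts θ≈φ)

    ·ᵥ-cong : ∀ {n} (ts : Vec Term n) {θ φ} → AgreeOn (varsVec ts) θ φ → ts ·ᵥ θ ≡ ts ·ᵥ φ
    ·ᵥ-cong []       θ≈φ = refl
    ·ᵥ-cong (t ∷ ts) θ≈φ = cong₂ _∷_ (·ₜ-cong t (agree-⊆ (xs⊆xs++ys _ _) θ≈φ))
                                     (·ᵥ-cong ts (agree-⊆ (xs⊆ys++xs _ (varsTerm t)) θ≈φ))

  ·-cong : ∀ A {θ φ} → AgreeOn (varsAtom A) θ φ → A · θ ≡ A · φ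
  ·-cong A θ≈φ = cong (atom (rel A)) (·ᵥ-cong (args A) θ≈φ)

  fun-injective : ∀ {f ss ts} → fun f ss ≡ fun f ts → ss ≡ ts
  fun-injective refl = refl

  atom-injective : ∀ {p ss ts} → atom p ss ≡ atom p ts → ss ≡ ts
  atom-injective refl = refl

  vec-∷-injective : ∀ {n s t} {ss ts : Vec Term n} → s ∷ ss ≡ t ∷ ts → s ≡ t × ss ≡ ts
  vec-∷-injective refl = refl , refl

  mutual
    ·ₜ-injective : ∀ t {θ φ} → t ·ₜ θ ≡ t ·ₜ φ → AgreeOn (varsTerm t) θ φ
    ·ₜ-injective (var x)    eq = agree λ { (here refl) → eq }
    ·ₜ-injective (fun f ts) eq = ·ᵥ-injective ts (fun-injective eq)

    ·ᵥ-injective : ∀ {n} (ts : Vec Term n) {θ φ} → ts ·ᵥ θ ≡ ts ·ᵥ φ → AgreeOn (varsVec ts) θ φ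
    ·ᵥ-injective []       eq = agree λ ()
    ·ᵥ-injective (t ∷ ts) eq with eq₁ , eq₂ ← vec-∷-injective eq =
      agree-++ (·ₜ-injective t eq₁) (·ᵥ-injective ts eq₂)

  -- An answer to an atom determines the values of all its variables. This turns finitely many
  -- answers into finitely many substitutions up to agreement.
  ·-injective : ∀ A {θ φ} → A · θ ≡ A · φ → AgreeOn (varsAtom A) θ φ
  ·-injective A eq = ·ᵥ-injective (args A) (atom-injective eq)

  map-·ₜ-cong : ∀ ts {θ φ} → AgreeOn (varsList ts) θ φ → map (_·ₜ θ) ts ≡ map (_·ₜ φ) ts
  map-·ₜ-cong []       _   = refl
  map-·ₜ-cong (t ∷ ts) θ≈φ = cong₂ _∷_ (·ₜ-cong t (agree-⊆ (xs⊆xs++ys _ _) θ≈φ))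
                                       (map-·ₜ-cong ts (agree-⊆ (xs⊆ys++xs _ (varsTerm t)) θ≈φ))

  map-·ₜ-injective : ∀ ts {θ φ} → map (_·ₜ θ) ts ≡ map (_·ₜ φ) ts → AgreeOn (varsList ts) θ φ
  map-·ₜ-injective []       eq = agree λ ()
  map-·ₜ-injective (t ∷ ts) eq with eq₁ , eq₂ ← ∷-injective eq =
    agree-++ (·ₜ-injective t eq₁) (map-·ₜ-injective ts eq₂)

  image : Subst → List Var → List Var
  image θ = concatMap (varsTerm ∘ at θ)

  image-++ : ∀ θ V W → image θ (V ++ W) ≡ image θ V ++ image θ W
  image-++ θ = concatMap-++ _

  image-⊆ : ∀ θ {V W} → V ⊆ W → image θ V ⊆ image θ W
  image-⊆ θ = concatMap⁺ _

  mutual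
    varsTerm-· : ∀ t θ → varsTerm (t ·ₜ θ) ≡ image θ (varsTerm t)
    varsTerm-· (var x)    θ = sym (++-identityʳ _)
    varsTerm-· (fun f ts) θ = varsVec-· ts θ

    varsVec-· : ∀ {n} (ts : Vec Term n) θ → varsVec (ts ·ᵥ θ) ≡ image θ (varsVec ts)
    varsVec-· []       θ = refl
    varsVec-· (t ∷ ts) θ = trans (cong₂ _++_ (varsTerm-· t θ) (varsVec-· ts θ))
                                 (sym (image-++ θ (varsTerm t) (varsVec ts)))

  varsList-· : ∀ ts θ → varsList (map (_·ₜ θ) ts) ≡ image θ (varsList ts)
  varsList-· []       θ = refl
  varsList-· (t ∷ ts) θ = trans (cong₂ _++_ (varsTerm-· t θ) (varsList-· ts θ))
                                (sym (image-++ θ (varsTerm t) (varsList ts)))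

  select-· : ∀ m {n} (ms : Vec Mode n) ts θ → select m ms (ts ·ᵥ θ) ≡ map (_·ₜ θ) (select m ms ts)
  select-· m      []            []       θ = refl
  select-· input  (input  ∷ ms) (t ∷ ts) θ = cong (_ ∷_) (select-· input ms ts θ)
  select-· input  (output ∷ ms) (t ∷ ts) θ = select-· input ms ts θ
  select-· output (input  ∷ ms) (t ∷ ts) θ = select-· output ms ts θ
  select-· output (output ∷ ms) (t ∷ ts) θ = cong (_ ∷_) (select-· output ms ts θ)

  select⊆vars : ∀ m {n} (ms : Vec Mode n) ts → varsList (select m ms ts) ⊆ varsVec ts
  select⊆vars input  []            []       = ⊆-refl
  select⊆vars output []            []       = ⊆-refl
  select⊆vars input  (input  ∷ ms) (t ∷ ts) = ++⁺ʳ (varsTerm t) (select⊆vars input ms ts)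
  select⊆vars input  (output ∷ ms) (t ∷ ts) = ∈-++⁺ʳ (varsTerm t) ∘ select⊆vars input ms ts
  select⊆vars output (input  ∷ ms) (t ∷ ts) = ∈-++⁺ʳ (varsTerm t) ∘ select⊆vars output ms ts
  select⊆vars output (output ∷ ms) (t ∷ ts) = ++⁺ʳ (varsTerm t) (select⊆vars output ms ts)

  vars⊆select : ∀ {n} (ms : Vec Mode n) ts {V} →
    varsList (select input ms ts) ⊆ V → varsList (select output ms ts) ⊆ V → varsVec ts ⊆ V
  vars⊆select (input  ∷ ms) (t ∷ ts) i o =
    ⊆-++-elim (i ∘ ∈-++⁺ˡ) (vars⊆select ms ts (i ∘ ∈-++⁺ʳ (varsTerm t)) o)
  vars⊆select (output ∷ ms) (t ∷ ts) i o =
    ⊆-++-elim (o ∘ ∈-++⁺ˡ) (vars⊆select ms ts i (o ∘ ∈-++⁺ʳ (varsTerm t)))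
  vars⊆select [] [] i o ()

  inVars⊆varsAtom : ∀ A → inVars A ⊆ varsAtom A
  inVars⊆varsAtom A = select⊆vars input (mode (rel A)) (args A)

  outVars⊆varsAtom : ∀ A → outVars A ⊆ varsAtom A
  outVars⊆varsAtom A = select⊆vars output (mode (rel A)) (args A)

  varsAtom⊆ : ∀ A {V} → inVars A ⊆ V → outVars A ⊆ V → varsAtom A ⊆ V
  varsAtom⊆ A = vars⊆select (mode (rel A)) (args A)

  inputs-· : ∀ A θ → inputs (A · θ) ≡ map (_·ₜ θ) (inputs A)
  inputs-· A = select-· input (mode (rel A)) (args A)

  outputs-· : ∀ A θ → outputs (A · θ) ≡ map (_·ₜ θ) (outputs A)
  outputs-· A = select-· output (mode (rel A)) (args A)

  inVars-· : ∀ A θ → inVars (A · θ) ≡ image θ (inVars A)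
  inVars-· A θ = trans (cong varsList (inputs-· A θ)) (varsList-· (inputs A) θ)

  outVars-· : ∀ A θ → outVars (A · θ) ≡ image θ (outVars A)
  outVars-· A θ = trans (cong varsList (outputs-· A θ)) (varsList-· (outputs A) θ)

  concatMap-outVars-·q : ∀ Bs θ → concatMap outVars (Bs ·q θ) ≡ image θ (concatMap outVars Bs)
  concatMap-outVars-·q []       θ = refl
  concatMap-outVars-·q (B ∷ Bs) θ = trans (cong₂ _++_ (outVars-· B θ) (concatMap-outVars-·q Bs θ))
                                          (sym (image-++ θ (outVars B) (concatMap outVars Bs)))

  Ground : Atom → Set
  Ground A = varsAtom A ≡ []

  GroundOn : List Var → Subst → Set
  GroundOn V θ = ∀ x → x ∈ V → varsTerm (at θ x) ≡ []

  image≡[]⇒GroundOn : ∀ θ V → image θ V ≡ [] → GroundOn V θ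
  image≡[]⇒GroundOn θ V eq x x∈V =
    ⊆[]⇒≡[] (λ y∈ → subst (_ ∈_) eq (∈⇒⊆concatMap (varsTerm ∘ at θ) x∈V y∈))

  Ground⇒GroundOn : ∀ A θ → Ground (A · θ) → GroundOn (varsAtom A) θ
  Ground⇒GroundOn A θ g = image≡[]⇒GroundOn θ (varsAtom A) (trans (sym (varsVec-· (args A) θ)) g)

  mutual
    ground-·ₜ : ∀ t θ → varsTerm t ≡ [] → t ·ₜ θ ≡ t
    ground-·ₜ (fun f ts) θ g = cong (fun f) (ground-·ᵥ ts θ g)

    ground-·ᵥ : ∀ {n} (ts : Vec Term n) θ → varsVec ts ≡ [] → ts ·ᵥ θ ≡ ts
    ground-·ᵥ []       θ g = refl
    ground-·ᵥ (t ∷ ts) θ g = cong₂ _∷_ (ground-·ₜ t θ (⊆[]⇒≡[] (⊆-trans (xs⊆xs++ys _ _) (⊆-reflexive g))))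
      (ground-·ᵥ ts θ (⊆[]⇒≡[] (⊆-trans (xs⊆ys++xs _ (varsTerm t)) (⊆-reflexive g))))

  -- The equivalence that every moded level mapping respects; outputs are left free.
  SameCall : Atom → Atom → Set
  SameCall A B = rel A ≡ rel B × inputs A ≡ inputs B

  SameCall-sym : ∀ {A B} → SameCall A B → SameCall B A
  SameCall-sym (r , i) = sym r , sym i

  SameCall-trans : ∀ {A B C} → SameCall A B → SameCall B C → SameCall A C
  SameCall-trans (r , i) (r′ , i′) = trans r r′ , trans i i′

  agree⇒SameCall : ∀ A {θ φ} → AgreeOn (inVars A) θ φ → SameCall (A · θ) (A · φ)
  agree⇒SameCall A {θ} {φ} θ≈φ =
    refl , trans (inputs-· A θ) (trans (map-·ₜ-cong (inputs A) θ≈φ) (sym (inputs-· A φ)))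

  SameCall⇒agree : ∀ A {θ φ} → SameCall (A · θ) (A · φ) → AgreeOn (inVars A) θ φ
  SameCall⇒agree A {θ} {φ} (_ , eq) =
    map-·ₜ-injective (inputs A) (trans (sym (inputs-· A θ)) (trans eq (inputs-· A φ)))

-- Well modedness under permutation, instantiation and resolution.

module WellModedness (L : Language) (mode : Moding L) where
  open Programs L mode
  open Substitution L mode

  -- The recursive form of `WellModedBody`: the variables available so far accumulate in `V`, which
  -- suits induction along the body.
  WellModedFrom : List Var → Query → Set
  WellModedFrom V []       = ⊤
  WellModedFrom V (B ∷ Bs) = inVars B ⊆ V × WellModedFrom (V ++ outVars B) Bs

  fromWellModedBody : ∀ {V} Bs → WellModedBody V Bs → WellModedFrom V Bs
  fromWellModedBody         []       wm = tt
  fromWellModedBody {V = V} (B ∷ Bs) wm =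
    ⊆-trans (wm zero) (⊆-reflexive (++-identityʳ V)) ,
    fromWellModedBody Bs (λ i → ⊆-trans (wm (suc i)) (⊆-reflexive (sym (++-assoc V _ _))))

  wellModed-⊆ : ∀ {V W} Bs → V ⊆ W → WellModedFrom V Bs → WellModedFrom W Bs
  wellModed-⊆ []       V⊆W _          = tt
  wellModed-⊆ (B ∷ Bs) V⊆W (i , wm) = ⊆-trans i V⊆W , wellModed-⊆ Bs (⊆-++⁺ˡ _ V⊆W) wm

  wellModed-++⁺ : ∀ {V} Bs {Cs} → WellModedFrom V Bs →
    WellModedFrom (V ++ concatMap outVars Bs) Cs → WellModedFrom V (Bs ++ Cs)
  wellModed-++⁺ {V} []       {Cs} _        wm′ = subst (λ W → WellModedFrom W Cs) (++-identityʳ V) wm′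
  wellModed-++⁺ {V} (B ∷ Bs) {Cs} (i , wm) wm′ =
    i , wellModed-++⁺ Bs wm (subst (λ W → WellModedFrom W Cs) (sym (++-assoc V _ _)) wm′)

  wellModed-++⁻ : ∀ {V} Bs {Cs} → WellModedFrom V (Bs ++ Cs) →
    WellModedFrom V Bs × WellModedFrom (V ++ concatMap outVars Bs) Cs
  wellModed-++⁻ {V} []       {Cs} wm       = tt , subst (λ W → WellModedFrom W Cs) (sym (++-identityʳ V)) wm
  wellModed-++⁻ {V} (B ∷ Bs) {Cs} (i , wm) with wm₁ , wm₂ ← wellModed-++⁻ Bs wm =
    (i , wm₁) , subst (λ W → WellModedFrom W Cs) (++-assoc V _ _) wm₂

  wellModed-· : ∀ {V} Bs θ → WellModedFrom V Bs → WellModedFrom (image θ V) (Bs ·q θ)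
  wellModed-· []       θ _        = tt
  wellModed-· {V} (B ∷ Bs) θ (i , wm) =
    ⊆-trans (⊆-reflexive (inVars-· B θ)) (image-⊆ θ i) ,
    subst (λ W → WellModedFrom W (Bs ·q θ))
      (trans (image-++ θ V (outVars B)) (cong (image θ V ++_) (sym (outVars-· B θ))))
      (wellModed-· Bs θ wm)

  wellModed-vars : ∀ {V} Bs → WellModedFrom V Bs → ∀ {B} → B ∈ Bs →
    varsAtom B ⊆ V ++ concatMap outVars Bs
  wellModed-vars {V} (B ∷ Bs) (i , _)  (here refl) =
    varsAtom⊆ B (∈-++⁺ˡ ∘ i) (∈-++⁺ʳ V ∘ ∈-++⁺ˡ)
  wellModed-vars {V} (B ∷ Bs) (_ , wm) (there B∈) =
    ⊆-trans (wellModed-vars Bs wm B∈) (⊆-reflexive (++-assoc V _ _))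

  PermWellModed : Query → Set
  PermWellModed = PermutationQuery (WellModedFrom [])

  WellModedHead : Clause → Set
  WellModedHead (H ⟵ Bs) =
    ∃[ Cs ] (Bs ↭ Cs × WellModedFrom (inVars H) Cs × outVars H ⊆ inVars H ++ concatMap outVars Cs)

  wellModedHead : ∀ {c} → PermutationClause WellModedClause c → WellModedHead c
  wellModedHead (Cs , perm , wm , o) = Cs , perm , fromWellModedBody Cs wm , o

  wellModedHead-· : ∀ c θ → WellModedHead c → WellModedHead (c ·c θ)
  wellModedHead-· (H ⟵ Bs) θ (Cs , perm , wm , o) =
    Cs ·q θ , ↭-map⁺ (_· θ) perm ,
    subst (λ W → WellModedFrom W (Cs ·q θ)) (sym (inVars-· H θ)) (wellModed-· Cs θ wm) ,
    ⊆-trans (⊆-reflexive (outVars-· H θ)) (⊆-trans (image-⊆ θ o)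
      (⊆-reflexive (trans (image-++ θ (inVars H) _)
        (cong₂ _++_ (sym (inVars-· H θ)) (sym (concatMap-outVars-·q Cs θ))))))

  -- Put the well moded order `Es` of the new body where `B` stands in the well moded order of the
  -- query. What precedes `B` covers its inputs, hence makes `Es` well moded there; the outputs of
  -- `B` come from its inputs and the outputs of `Es`, so the atoms after `B` lose no variable.
  replace-wellModed : ∀ As {B Cs} Ds → PermWellModed (As ++ B ∷ Cs) →
    WellModedHead (B ⟵ Ds) → PermWellModed (As ++ Ds ++ Cs)
  replace-wellModed As {B} {Cs} Ds (Q , perm , wm) (Es , Ds↭Es , wmE , outB)
    with As′ , Cs′ , refl ← ∈-∃++ (∈-resp-↭ perm (∈-++⁺ʳ As (here refl)))
    with wmA , inB , wmC ← wellModed-++⁻ As′ wm =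
    As′ ++ Es ++ Cs′ ,
    ↭-trans (shifts As Ds) (↭-trans (↭-++⁺ Ds↭Es (drop-mid As As′ perm)) (shifts Es As′)) ,
    wellModed-++⁺ As′ wmA (wellModed-++⁺ Es (wellModed-⊆ Es inB wmE)
      (wellModed-⊆ Cs′ (⊆-++-elim {xs = concatMap outVars As′} ∈-++⁺ˡ
        (⊆-trans outB (⊆-++⁺ˡ _ inB))) wmC))

  -- Well modedness is stable under instantiation, and after the mgu the head of the clause variant
  -- is the selected atom. Resolution is then a replacement of this atom by the body.
  resolvent-wellModed : ∀ {P} → All (PermutationClause WellModedClause) P →
    (D : Fragment P) (s : Step D) → PermWellModed (lastQuery D) → PermWellModed (lastQuery (extend D s))
  resolvent-wellModed wmP D s wmD =
    subst PermWellModed (sym resolvent)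
      (replace-wellModed (As ·q σ) (body c ·q σ)
        (subst PermWellModed selected (instance-wellModed wmD))
        (subst (λ H → WellModedHead (H ⟵ (body c ·q σ))) (sym (proj₁ isMgu)) wmHead))
    where
    open Step s renaming (variant to c; mgu to σ)
    Q  = lastQuery D
    B  = lookup Q position
    As = take (toℕ position) Q
    Cs = drop (suc (toℕ position)) Q

    instance-wellModed : ∀ {Q} → PermWellModed Q → PermWellModed (Q ·q σ)
    instance-wellModed (Q′ , perm , wm) = Q′ ·q σ , ↭-map⁺ (_· σ) perm , wellModed-· Q′ σ wm

    selected : Q ·q σ ≡ (As ·q σ) ++ (B · σ) ∷ (Cs ·q σ)
    selected = trans (cong (_·q σ) (lookup-split Q position)) (map-++ (_· σ) As (B ∷ Cs))

    resolvent : lastQuery (extend D s) ≡ (As ·q σ) ++ (body c ·q σ) ++ (Cs ·q σ)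
    resolvent = trans (map-++ (_· σ) As _) (cong ((As ·q σ) ++_) (map-++ (_· σ) (body c) Cs))

    wmHead : WellModedHead (c ·c σ)
    wmHead with ρ , _ , refl ← proj₁ apart =
      wellModedHead-· _ σ (wellModedHead-· clause ρ (wellModedHead (All.lookup wmP clause∈P)))

  -- The first atom of a well moded order has no earlier outputs from which to draw input variables.
  groundInput : ∀ {Q} → PermWellModed Q → Q ≢ [] → ∃[ i ] inVars (lookup Q i) ≡ []
  groundInput (B ∷ Bs , perm , i , _) _ =
    index B∈Q , trans (cong inVars (sym (Any.lookup-index B∈Q))) (⊆[]⇒≡[] i)
    where B∈Q = ∈-resp-↭ (↭-sym perm) (here refl)
  groundInput {[]}    ([] , _) Q≢[] = contradiction refl Q≢[]
  groundInput {B ∷ Q} ([] , perm , _) _ with () ← ∈-resp-↭ perm (here refl)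

-- Selecting atoms with ground inputs: statement (1).

module InputTermination (em : ∀ {ℓ} → ExcludedMiddle ℓ) (L : Language) (mode : Moding L) where
  open Language L
  open Programs L mode
  open Substitution L mode
  open WellModedness L mode

  GroundInput : Query → Set
  GroundInput Q = ∃[ i ] inVars (lookup Q i) ≡ []

  pick : ∀ Q → Dec (GroundInput Q) → Maybe (Fin (length Q))
  pick Q       (yes (i , _)) = just i
  pick []      (no _)        = nothing
  -- A default: a standard rule must select an atom even if none has ground inputs.
  pick (_ ∷ _) (no _)        = just zero

  pick-nonempty : ∀ Q d → Q ≢ [] → ∃[ i ] pick Q d ≡ just i
  pick-nonempty Q       (yes (i , _)) _    = i , refl
  pick-nonempty []      (no _)        Q≢[] = contradiction refl Q≢[]
  pick-nonempty (_ ∷ _) (no _)        _    = zero , refl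

  pick-ground : ∀ {Q i} d → GroundInput Q → pick Q d ≡ just i → inVars (lookup Q i) ≡ []
  pick-ground (yes (_ , ground)) _ refl = ground
  pick-ground (no ¬ground)       g _    = contradiction g ¬ground

  module _ (P : Program) where

    clausesFor : Atom → List Clause
    clausesFor A = filter (λ c → em {P = rel (head c) ≡ rel A}) P

    -- An input-consuming rule may offer only clauses that unify with the atom, whereas a standard
    -- rule offers all those for its predicate.
    resolvable : (D : Fragment P) → Fin (length (lastQuery D)) → List Clause
    resolvable D i = filter (λ c → em {P = ∃₂ λ c′ σ →
      RenamedApart D c c′ × IsMgu σ (lookup (lastQuery D) i) (head c′)}) P

    groundRule : SelectionRule P
    groundRule D = Maybe.map (λ i → i , clausesFor (lookup (lastQuery D) i)) (pick (lastQuery D) em)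

    clausesFor-spec : ∀ A c → c ∈ clausesFor A ⇔ (c ∈ P × rel (head c) ≡ rel A)
    clausesFor-spec A c =
      mk⇔ (∈-filter⁻ (λ _ → em) {xs = P}) (λ (c∈P , eq) → ∈-filter⁺ (λ _ → em) c∈P eq)

    groundRule-standard : Standard groundRule
    groundRule-standard D Q≢[] with i , eq ← pick-nonempty (lastQuery D) em Q≢[] =
      i , _ , cong (Maybe.map _) eq , clausesFor-spec (lookup (lastQuery D) i)

    InputConsumingAt : (D : Fragment P) → Maybe (Selection D) → Set
    InputConsumingAt D r =
      (∃[ S ] (r ≡ just S × Resolving D S)) ⊎
      (∃[ S ] (r ≡ just S × Failing D S)) ⊎
      (r ≡ nothing × (∀ S → ¬ Resolving D S × ¬ Failing D S))

    -- The third case of the definition is the negation of the other two, so a legal choice always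
    -- exists. It completes `followRule` on the fragments where the choice of `groundRule` cannot be
    -- imitated.
    inputConsuming : ∀ D → ∃[ r ] InputConsumingAt D r
    inputConsuming D with em {P = ∃[ S ] Resolving D S} | em {P = ∃[ S ] Failing D S}
    ... | yes (S , res) | _              = just S , inj₁ (S , refl , res)
    ... | no _          | yes (S , fail) = just S , inj₂ (inj₁ (S , refl , fail))
    ... | no ¬res       | no ¬fail       =
      nothing , inj₂ (inj₂ (refl , λ S → (λ r → ¬res (S , r)) , (λ f → ¬fail (S , f))))

    FollowsGround : Fragment P → Set
    FollowsGround D =
      ∃[ i ] (pick (lastQuery D) em ≡ just i × Resolving D (i , resolvable D i))

    follow : ∀ D → Dec (FollowsGround D) → Maybe (Selection D)
    follow D (yes (i , _)) = just (i , resolvable D i)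
    follow D (no _)        = proj₁ (inputConsuming D)

    followRule : SelectionRule P
    followRule D = follow D em

    followRule-inputConsuming : InputConsuming followRule
    followRule-inputConsuming D _ = consuming em
      where
      consuming : ∀ d → InputConsumingAt D (follow D d)
      consuming (yes (i , _ , res)) = inj₁ ((i , resolvable D i) , refl , res)
      consuming (no _)              = proj₂ (inputConsuming D)

    -- With no variable in the inputs, the condition on the domain of the mgu is vacuous. The clause
    -- used by the step shows that the offered list is non-empty.
    groundStep-resolving : ∀ D (s : Step D) → inVars (lookup (lastQuery D) (Step.position s)) ≡ [] →
      Step.clause s ∈ resolvable D (Step.position s) ×
      Resolving D (Step.position s , resolvable D (Step.position s))
    groundStep-resolving D s ground = c∈ ,
      (λ eq → contradiction (subst (clause ∈_) eq c∈) λ ()) ,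
      (λ c∈ → proj₁ (∈-filter⁻ (λ _ → em) {xs = P} c∈)) ,
      λ c c∈ → let c′ , σ , apart′ , isMgu′ = proj₂ (∈-filter⁻ (λ _ → em) {xs = P} c∈) in
        c′ , σ , apart′ , isMgu′ , λ x _ x∈ → contradiction (subst (x ∈_) ground x∈) λ ()
      where
      open Step s
      c∈ : clause ∈ resolvable D position
      c∈ = ∈-filter⁺ (λ _ → em) clause∈P (variant , mgu , apart , isMgu)

    -- The two rules offer different lists of clauses, but the clause of an actual step unifies with
    -- the selected atom and so belongs to the smaller list too.
    via-followRule : ∀ D (s : Step D) → PermWellModed (lastQuery D) → Via groundRule D s → Via followRule D s
    via-followRule D s wm (cs , eq , _) = resolvable D position , follows em , proj₁ resolving
      where
      open Step s

      pick≡ : pick (lastQuery D) em ≡ just position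
      pick≡ = map-pair⁻ (pick (lastQuery D) em) eq
        where
        map-pair⁻ : ∀ {A B : Set} {f : A → B} m {a b} → Maybe.map (λ x → x , f x) m ≡ just (a , b) → m ≡ just a
        map-pair⁻ (just _) refl = refl

      resolving : clause ∈ resolvable D position × Resolving D (position , resolvable D position)
      resolving = groundStep-resolving D s (pick-ground em (groundInput wm λ Q≡[] → no-position Q≡[] position) pick≡)
        where
        no-position : ∀ {Q : Query} → Q ≡ [] → ¬ Fin (length Q)
        no-position refl ()

      follows : ∀ d → follow D d ≡ just (position , resolvable D position)
      -- Both indices are the value of the same `pick`.
      follows (yes (i , pick≡i , _)) with refl ← trans (sym pick≡i) pick≡ = refl
      follows (no ¬follows) = contradiction (position , pick≡ , proj₂ resolving) ¬follows

    ∃-terminate : ∀ Q → All (PermutationClause WellModedClause) P → PermutationQuery WellModedQuery Q →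
      InputTerminate P Q → ∃-Terminate P Q
    ∃-terminate Q wmP (Q′ , perm , wmQ) terminates =
      (_≡ groundRule) , (groundRule , refl) , (λ { _ refl → groundRule-standard }) ,
      λ { _ refl derivation → terminates followRule followRule-inputConsuming (following derivation) }
      where
      following : InfiniteDerivation P Q groundRule → InfiniteDerivation P Q followRule
      following δ = record
        { fragment = fragment ; starts = starts ; step = step ; extends = extends
        ; via = λ n → via-followRule (fragment n) (step n) (wellModed n) (via n) }
        where
        open InfiniteDerivation δ
        wellModed : ∀ n → PermWellModed (lastQuery (fragment n))
        wellModed zero    = subst (PermWellModed ∘ lastQuery) (sym starts) (Q′ , perm , fromWellModedBody Q′ wmQ)
        wellModed (suc n) = subst (PermWellModed ∘ lastQuery) (sym (extends n))
          (resolvent-wellModed wmP (fragment n) (step n) (wellModed n))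

-- Simply-local substitutions and simply moded atoms.

module SimpleLocality (L : Language) (mode : Moding L) where
  open Programs L mode
  open Substitution L mode
  open WellModedness L mode

  restrict : Subst → List Var → Subst
  restrict θ V = mkSubst restricted (proj₁ (finite θ) , identity)
    where
    restricted : Var → Term
    restricted x with x ∈? V
    ... | yes _ = at θ x
    ... | no _  = var x

    identity : ∀ x → proj₁ (finite θ) ≤ x → restricted x ≡ var x
    identity x n≤x with x ∈? V
    ... | yes _ = proj₂ (finite θ) x n≤x
    ... | no _  = refl

  restrict-∈ : ∀ θ {V x} → x ∈ V → at (restrict θ V) x ≡ at θ x
  restrict-∈ θ {V} {x} x∈V with x ∈? V
  ... | yes _  = refl
  ... | no x∉V = contradiction x∈V x∉V

  restrict-∉ : ∀ θ {V x} → x ∉ V → at (restrict θ V) x ≡ var x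
  restrict-∉ θ {V} {x} x∉V with x ∈? V
  ... | yes x∈V = contradiction x∈V x∉V
  ... | no _    = refl

  restrict-agree : ∀ θ V → AgreeOn V (restrict θ V) θ
  restrict-agree θ V = agree (restrict-∈ θ)

  GroundOrIdentity : Subst → Set
  GroundOrIdentity θ = ∀ x → varsTerm (at θ x) ≡ [] ⊎ at θ x ≡ var x

  restrict-groundOrIdentity : ∀ θ V → GroundOn V θ → GroundOrIdentity (restrict θ V)
  restrict-groundOrIdentity θ V g x with x ∈? V
  ... | yes x∈V = inj₁ (g x x∈V)
  ... | no _    = inj₂ refl

  module _ (θ : Subst) (ground : GroundOrIdentity θ) where

    -- A variable bound by the first restriction has a ground value, which the second cannot change,
    -- so composing merely unites the sets of bound variables.
    restrict-⨾ : ∀ U V → (restrict θ U ⨾ restrict θ V) ≐ restrict θ (U ++ V)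
    restrict-⨾ U V x with x ∈? U
    ... | yes x∈U with ground x
    ...   | inj₁ g  = trans (ground-·ₜ (at θ x) (restrict θ V) g) (sym (restrict-∈ θ (∈-++⁺ˡ x∈U)))
    ...   | inj₂ eq rewrite restrict-∈ θ {U ++ V} (∈-++⁺ˡ x∈U) | eq with x ∈? V
    ...     | yes _ = eq
    ...     | no _  = refl
    restrict-⨾ U V x | no x∉U with x ∈? V
    ... | yes x∈V = sym (restrict-∈ θ (∈-++⁺ʳ U x∈V))
    ... | no x∉V  = sym (restrict-∉ θ ([ x∉U , x∉V ]′ ∘ ∈-++⁻ U))

    restrict-Dom : ∀ V {x} → Dom (restrict θ V) x → x ∈ V
    restrict-Dom V {x} dom with x ∈? V
    ... | yes x∈V = x∈V
    ... | no _    = contradiction refl dom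

    restrict-Ran : ∀ V {y} → ¬ Ran (restrict θ V) y
    restrict-Ran V {y} (x , dom , y∈) with x ∈? V
    ... | no _ = dom refl
    ... | yes _ with ground x
    ...   | inj₁ g  = contradiction (subst (y ∈_) g y∈) λ ()
    ...   | inj₂ eq = dom eq

    module _ (c : Clause) where

      -- The variables bound by σₖ: those of 𝐭ₖ, with 𝐭₀ the input of the head.
      outVarsAt : Query → ℕ → List Var
      outVarsAt []       k       = []
      outVarsAt (B ∷ Bs) zero    = outVars B
      outVarsAt (B ∷ Bs) (suc k) = outVarsAt Bs k

      stage : ℕ → List Var
      stage zero    = inVars (head c)
      stage (suc k) = outVarsAt (body c) k

      stages : ℕ → List Var
      stages zero    = []
      stages (suc k) = stages k ++ stage k

      outVarsAt-lookup : ∀ Bs (i : Fin (length Bs)) → outVarsAt Bs (toℕ i) ≡ outVars (lookup Bs i)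
      outVarsAt-lookup (B ∷ Bs) zero    = refl
      outVarsAt-lookup (B ∷ Bs) (suc i) = outVarsAt-lookup Bs i

      ∈-outVarsAt : ∀ Bs {x} → x ∈ concatMap outVars Bs → ∃[ k ] (k < length Bs × x ∈ outVarsAt Bs k)
      ∈-outVarsAt (B ∷ Bs) x∈ with ∈-++⁻ (outVars B) x∈
      ... | inj₁ x∈B  = zero , s≤s z≤n , x∈B
      ... | inj₂ x∈Bs with k , k< , x∈k ← ∈-outVarsAt Bs x∈Bs = suc k , s≤s k< , x∈k

      stage⊆stages : ∀ {k m} → k < m → stage k ⊆ stages m
      stage⊆stages {k} {suc m} k<1+m x∈ with m<1+n⇒m<n∨m≡n k<1+m
      ... | inj₁ k<m  = ∈-++⁺ˡ (stage⊆stages k<m x∈)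
      ... | inj₂ refl = ∈-++⁺ʳ (stages m) x∈

      bound⊆stages : inVars (head c) ++ concatMap outVars (body c) ⊆ stages (suc (length (body c)))
      bound⊆stages x∈ with ∈-++⁻ (inVars (head c)) x∈
      ... | inj₁ x∈in  = stage⊆stages {0} {suc (length (body c))} (s≤s z≤n) x∈in
      ... | inj₂ x∈out with k , k< , x∈k ← ∈-outVarsAt (body c) x∈out = stage⊆stages {suc k} (s≤s k<) x∈k

      compose-stages : ∀ k → compose (restrict θ ∘ stage) k ≐ restrict θ (stages k)
      compose-stages zero    x = sym (restrict-∉ θ {[]} {x} λ ())
      compose-stages (suc k) x =
        trans (cong (_·ₜ restrict θ (stage k)) (compose-stages k x)) (restrict-⨾ (stages k) (stage k) x)

      -- Take for `σ k` the restriction of `θ` to the variables of its stage. All values it binds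
      -- are ground, so the ranges are empty and every set of fresh variables can be empty.
      simplyLocal : (∀ {x} → x ∉ inVars (head c) ++ concatMap outVars (body c) → at θ x ≡ var x) →
        SimplyLocal c θ
      simplyLocal dom =
        restrict θ ∘ stage , (λ _ _ → ⊥) , (λ _ _ _ _ _ _ ()) , (λ _ _ _ ()) ,
        (λ x → trans (everywhere x) (sym (compose-stages (suc (length (body c))) x))) ,
        (λ x → restrict-Dom (stage 0)) ,
        (λ x ran → ⊥-elim (restrict-Ran (stage 0) ran)) ,
        λ i → (λ x d → subst (x ∈_) (outVarsAt-lookup (body c) i) (restrict-Dom (stage (suc (toℕ i))) d)) ,
              (λ x ran → ⊥-elim (restrict-Ran (stage (suc (toℕ i))) ran))
        where
        everywhere : ∀ x → at θ x ≡ at (restrict θ (stages (suc (length (body c))))) x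
        everywhere x with x ∈? stages (suc (length (body c)))
        ... | yes _  = refl
        ... | no x∉ = dom (x∉ ∘ bound⊆stages)

  -- `V` may omit outputs of the body, so that a partially evaluated clause instance is covered as
  -- well as a ground one.
  simplyLocal-restrict : ∀ c θ V → V ⊆ inVars (head c) ++ concatMap outVars (body c) → GroundOn V θ →
    SimplyLocal c (restrict θ V)
  simplyLocal-restrict c θ V V⊆ g =
    simplyLocal (restrict θ V) (restrict-groundOrIdentity θ V g) c (λ x∉ → restrict-∉ θ (x∉ ∘ V⊆))

  LinearOutputs : Atom → Set
  LinearOutputs A = ∃[ xs ] (outputs A ≡ map var xs × Unique xs)

  varsList-map-var : ∀ xs → varsList (map var xs) ≡ xs
  varsList-map-var []       = refl
  varsList-map-var (x ∷ xs) = cong (x ∷_) (varsList-map-var xs)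

  -- Cutting a list of distinct variables along the atoms leaves each piece free of repetitions and
  -- the pieces pairwise disjoint. This form no longer depends on the order of the atoms.
  linearOutputs : ∀ Bs {xs} → concatMap outputs Bs ≡ map var xs → Unique xs →
    All LinearOutputs Bs × AllPairs (Disjoint on outVars) Bs
  linearOutputs []       _  _ = [] , []
  linearOutputs (B ∷ Bs) {xs} eq unique
    with ys , zs , refl , eqB , eqBs ← ++≡map⁻ (outputs B) xs eq
    with linear , disjoint ← linearOutputs Bs eqBs (AllPairs-++⁻ʳ ys unique) =
    (ys , eqB , AllPairs-++⁻ˡ ys unique) ∷ linear ,
    All.tabulate (λ B′∈ (v∈B , v∈B′) → AllPairs-++⁻-cross ys unique
      (subst (_ ∈_) (trans (cong varsList eqB) (varsList-map-var ys)) v∈B)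
      (later B′∈ v∈B′) refl) ∷ disjoint
    where
    varsList-concatMap : ∀ Bs → concatMap outVars Bs ≡ varsList (concatMap outputs Bs)
    varsList-concatMap []       = refl
    varsList-concatMap (B ∷ Bs) =
      trans (cong (outVars B ++_) (varsList-concatMap Bs)) (sym (concatMap-++ varsTerm (outputs B) _))

    later : ∀ {B′ v} → B′ ∈ Bs → v ∈ outVars B′ → v ∈ zs
    later B′∈ v∈ = subst (_ ∈_)
      (trans (varsList-concatMap Bs) (trans (cong varsList eqBs) (varsList-map-var zs)))
      (∈⇒⊆concatMap outVars B′∈ v∈)

  -- The permutation invariant content of simple modedness.
  SimpleBody : List Var → Query → Set
  SimpleBody V Bs =
    All LinearOutputs Bs × AllPairs (Disjoint on outVars) Bs ×
    All (λ B → Disjoint (outVars B) V × Disjoint (outVars B) (inVars B)) Bs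

  simpleBody-↭ : ∀ {V Bs Cs} → Bs ↭ Cs → SimpleBody V Bs → SimpleBody V Cs
  simpleBody-↭ perm (linear , disjoint , apart) =
    All-resp-↭ perm linear ,
    AllPairs-resp-↭ (setoid Atom) (λ {B} {C} → flipped {B} {C}) (resp₂ (Disjoint on outVars)) (↭⇒↭ₛ perm) disjoint ,
    All-resp-↭ perm apart
    where
    flipped : ∀ {B C} → Disjoint (outVars B) (outVars C) → Disjoint (outVars C) (outVars B)
    flipped B#C (v∈C , v∈B) = B#C (v∈B , v∈C)

  simpleBody : ∀ {V} Bs → SimplyModedBody V Bs → SimpleBody V Bs
  simpleBody {V} Bs ((xs , eq , unique) , apart)
    with linear , disjoint ← linearOutputs Bs eq unique =
    linear , disjoint , All.tabulate own
    where
    own-index : ∀ Bs (i : Fin (length Bs)) → lookup Bs i ∈ take (suc (toℕ i)) Bs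
    own-index (B ∷ Bs) zero    = here refl
    own-index (B ∷ Bs) (suc i) = there (own-index Bs i)

    own : ∀ {B} → B ∈ Bs → Disjoint (outVars B) V × Disjoint (outVars B) (inVars B)
    own B∈ = subst (λ B → Disjoint (outVars B) V × Disjoint (outVars B) (inVars B))
      (sym (Any.lookup-index B∈))
      (proj₁ (apart i) , λ (v∈out , v∈in) →
        proj₂ (apart i) (v∈out , ∈⇒⊆concatMap inVars (own-index Bs i) v∈in))
      where i = index B∈

  simplyModedClause⇒simpleBody : ∀ c → PermutationClause SimplyModedClause c → SimpleBody (inVars (head c)) (body c)
  simplyModedClause⇒simpleBody c (Cs , perm , sm) = simpleBody-↭ (↭-sym perm) (simpleBody Cs sm)

  -- The outputs avoid `V` and stay distinct variables. Each input variable either becomes ground or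
  -- stays itself, so no output variable can enter the inputs.
  SM-restrict : ∀ B θ V → LinearOutputs B → Disjoint (outVars B) (inVars B) →
    Disjoint (outVars B) V → GroundOn V θ → SM (B · restrict θ V)
  SM-restrict B θ V (xs , eq , unique) out#in out#V g =
    (xs , trans (++-identityʳ _) outputs≡ , unique) ,
    λ { zero → (λ ()) , λ (v∈out , v∈in) →
          disjoint (subst (_ ∈_) outVars≡ v∈out) (subst (_ ∈_) (++-identityʳ (inVars (B · restrict θ V))) v∈in) }
    where
    outVars-B : outVars B ≡ xs
    outVars-B = trans (cong varsList eq) (varsList-map-var xs)

    unchanged : ∀ ys → (∀ {y} → y ∈ ys → y ∉ V) → map (_·ₜ restrict θ V) (map var ys) ≡ map var ys
    unchanged []       _  = refl
    unchanged (y ∷ ys) ∉V = cong₂ _∷_ (restrict-∉ θ (∉V (here refl))) (unchanged ys (∉V ∘ there))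

    outputs≡ : outputs (B · restrict θ V) ≡ map var xs
    outputs≡ = trans (outputs-· B (restrict θ V)) (trans (cong (map (_·ₜ restrict θ V)) eq)
      (unchanged xs λ y∈ y∈V → out#V (subst (_ ∈_) (sym outVars-B) y∈ , y∈V)))

    outVars≡ : outVars (B · restrict θ V) ≡ outVars B
    outVars≡ = trans (cong varsList outputs≡) (trans (varsList-map-var xs) (sym outVars-B))

    disjoint : ∀ {v} → v ∈ outVars B → v ∉ inVars (B · restrict θ V)
    disjoint {v} v∈out v∈in
      with y , y∈in , v∈y ← find (∈-concatMap⁻ (varsTerm ∘ at (restrict θ V))
                               (subst (v ∈_) (inVars-· B (restrict θ V)) v∈in))
      with restrict-groundOrIdentity θ V g y
    ... | inj₁ ground = contradiction (subst (v ∈_) ground v∈y) λ ()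
    ... | inj₂ same with here refl ← subst (λ t → v ∈ varsTerm t) same v∈y = out#in (v∈out , y∈in)

-- The least Herbrand model and the least level mapping.

module FairBoundedness (em : ∀ {ℓ} → ExcludedMiddle ℓ) (L : Language) (mode : Moding L)
                       (P : Programs.Program L mode) where
  open Language L
  open Programs L mode
  open Substitution L mode
  open WellModedness L mode
  open SimpleLocality L mode

  -- The least Herbrand model of `P`, given by ground proof trees.
  data Success : Pred Atom 0ℓ where
    resolve : ∀ {c} → c ∈ P → ∀ θ → Ground (head c · θ) → All Success (body c ·q θ) → Success (head c · θ)

  success-ground : ∀ {A} → Success A → Ground A
  success-ground (resolve _ _ ground _) = ground

  -- Conditions (a) and (b) of fair-boundedness, with `T` in place of lying below the bound.
  FairlyIn : Pred Atom 0ℓ → Query → Set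
  FairlyIn T Bs = (All Success Bs → All T Bs) × (¬ All Success Bs → Any (λ B → ¬ Success B × T B) Bs)

  fairlyIn-map : ∀ {T U : Pred Atom 0ℓ} → (∀ {A} → T A → U A) → ∀ {Bs} → FairlyIn T Bs → FairlyIn U Bs
  fairlyIn-map T⇒U (success , failure) =
    All.map T⇒U ∘ success , Any.map (λ (¬s , t) → ¬s , T⇒U t) ∘ failure

  fairlyIn-↭ : ∀ {T Bs Cs} → Bs ↭ Cs → FairlyIn T Bs → FairlyIn T Cs
  fairlyIn-↭ perm (success , failure) =
    All-resp-↭ perm ∘ success ∘ All-resp-↭ (↭-sym perm) ,
    λ ¬all → Any-resp-↭ perm (failure (¬all ∘ All-resp-↭ perm))

  -- The atoms of level at most k in the least level mapping by which P is fair-bounded.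
  Terminates : ℕ → Pred Atom 0ℓ
  Terminates zero    A = ⊥
  Terminates (suc k) A = ∀ {c} → c ∈ P → ∀ θ → A ≡ head c · θ →
    All Ground (body c ·q θ) → FairlyIn (Terminates k) (body c ·q θ)

  terminates-≤ : ∀ {k m} → k ≤ m → ∀ {A} → Terminates k A → Terminates m A
  terminates-≤ (s≤s k≤m) t c∈P θ eq ground = fairlyIn-map (terminates-≤ k≤m) (t c∈P θ eq ground)

  record LeastLevel (A : Atom) : Set where
    field
      value   : ℕ ⁺
      attains : value ≡ ⊤⁺ ⊎ ∃[ k ] (value ≡ [ suc k ] × Terminates (suc k) A)
      least   : ∀ {k} → Terminates k A → [ suc k ] ▷ value
  open LeastLevel

  -- Descends from the given bound to the first number whose predecessor fails. As `Terminates 0` is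
  -- empty, the descent ends at a positive level.
  leastLevel : ∀ {A} k → Terminates k A → LeastLevel A
  leastLevel {A} (suc k) t with em {P = Terminates k A}
  ... | yes t′ = leastLevel k t′
  ... | no ¬t′ = record
    { value = [ suc k ] ; attains = inj₂ (k , refl , t)
    ; least = λ {m} tm → inj₂ [ s≤s (≰⇒> λ m≤k → ¬t′ (terminates-≤ m≤k tm)) ] }

  level : ∀ A → LeastLevel A
  level A with em {P = ∃[ k ] Terminates k A}
  ... | yes (k , t) = leastLevel k t
  ... | no ¬t       = record { value = ⊤⁺ ; attains = inj₁ refl ; least = λ t → contradiction (_ , t) ¬t }

  groundLevel : ExtendedLevelMapping
  groundLevel (A , _) = value (level A)

  groundSuccess : HerbrandInterpretation
  groundSuccess (A , _) = Success A

  bounds : ∀ {k} Bs → FairlyIn (Terminates k) (map proj₁ Bs) → Bounds groundLevel groundSuccess [ suc k ] Bs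
  bounds Bs (success , failure) =
    (λ all → All.map (λ {B} → least (level (proj₁ B))) (All.map⁻ (success (All.map⁺ all)))) ,
    (λ ¬all → Any.map (λ {B} (¬s , t) → ¬s , least (level (proj₁ B)) t)
                (Any.map⁻ (failure (¬all ∘ All.map⁻))))

  all-ground : ∀ (Bs : List HerbrandBase) → All Ground (map proj₁ Bs)
  all-ground Bs = All.map⁺ (All.universal proj₂ Bs)

  -- A head of level ∞ bounds everything, so (b) only asks for some body atom outside the model. For
  -- a head of finite level, `Terminates` unfolds to the two conditions.
  fairBounded : FairBounded P groundLevel groundSuccess
  fairBounded = model , clauses
    where
    model : IsModel groundSuccess P
    model (A , g) Bs (c , c∈P , θ , refl , eqs) all =
      resolve c∈P θ g (subst (All Success) eqs (All.map⁺ all))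

    clauses : ∀ A Bs → IsGroundClause P A Bs → Bounds groundLevel groundSuccess (groundLevel A) Bs
    clauses (A , g) Bs (c , c∈P , θ , eq , eqs) with attains (level A)
    ... | inj₁ ∞ = (λ _ → All.universal (λ _ → inj₁ ∞) Bs) ,
                   (λ ¬all → Any.map (λ ¬s → ¬s , inj₁ ∞) (All.¬All⇒Any¬ (λ _ → em) Bs ¬all))
    ... | inj₂ (k , eqk , t) =
      subst (λ b → Bounds groundLevel groundSuccess b Bs) (sym eqk)
        (bounds Bs (subst (FairlyIn (Terminates k)) (sym eqs)
          (t c∈P θ eq (subst (All Ground) eqs (all-ground Bs)))))

  -- Finite evaluation of calls and queries.

  FinitelyCalled : Atom → Set
  FinitelyCalled A = ∃₂ λ k As → ∀ {B} → Ground B → SameCall A B →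
    Terminates k B × (Success B → B ∈ As)

  -- Only calls reached after the success of all preceding atoms are constrained, since
  -- acceptability controls no others.
  CallsFinite : List Var → Subst → Query → Set
  CallsFinite V θ₀ Bs = ∀ Cs B Ds → Bs ≡ Cs ++ B ∷ Ds → ∀ θ → AgreeOn V θ₀ θ →
    All Success (Cs ·q θ) → FinitelyCalled (B · θ)

  -- `Θ` represents the answers only up to agreement on the variables bound so far; elsewhere the
  -- substitutions are arbitrary.
  Answered : List Var → Query → ℕ → List Subst → Subst → Set
  Answered V Bs k Θ θ = FairlyIn (Terminates k) (Bs ·q θ) ×
    (All Success (Bs ·q θ) → Any (AgreeOn (V ++ concatMap outVars Bs) θ) Θ)

  -- König's lemma for the left-to-right evaluation: each of the finitely many answers to the
  -- first atom leaves one evaluation of the rest.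
  query-finite : ∀ V Bs θ₀ → WellModedFrom V Bs → CallsFinite V θ₀ Bs →
    ∃₂ λ k Θ → ∀ {θ} → AgreeOn V θ₀ θ → All Ground (Bs ·q θ) → Answered V Bs k Θ θ
  query-finite V [] θ₀ _ _ = 0 , θ₀ ∷ [] , λ θ₀≈θ _ →
    ((λ _ → []) , λ ¬all → contradiction [] ¬all) ,
    λ _ → here (agree-sym (agree-⊆ (⊆-reflexive (++-identityʳ V)) θ₀≈θ))
  -- The inputs of `B` have their variables in `V`, so the instance by `θ₀` stands for the call made
  -- by every `θ` that agrees with it there.
  query-finite V (B ∷ Bs) θ₀ (inB , wm) calls with calls [] B Bs refl θ₀ agree-refl []
  ... | k₁ , As , first = k₁ ⊔ k₂ , Θ , answered
    where
    After : Atom → ℕ → List Subst → Set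
    After A k Θ = ∀ {θ} → AgreeOn V θ₀ θ → B · θ ≡ A → Success A → All Ground (Bs ·q θ) →
      Answered (V ++ outVars B) Bs k Θ θ

    after-mono : ∀ {A k m Θ Ξ} → k ≤ m → Θ ⊆ Ξ → After A k Θ → After A m Ξ
    after-mono k≤m Θ⊆Ξ f θ₀≈θ eq s ground with fair , answer ← f θ₀≈θ eq s ground =
      fairlyIn-map (terminates-≤ k≤m) fair , Any-resp-⊆ Θ⊆Ξ ∘ answer

    calls-rest : ∀ {φ} → AgreeOn V θ₀ φ → Success (B · φ) → CallsFinite (V ++ outVars B) φ Bs
    calls-rest θ₀≈φ s Cs C Ds eq θ φ≈θ all = calls (B ∷ Cs) C Ds (cong (B ∷_) eq) θ
      (agree-trans θ₀≈φ (agree-⊆ ∈-++⁺ˡ φ≈θ))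
      (subst Success (·-cong B (agree-⊆ (varsAtom⊆ B (∈-++⁺ˡ ∘ inB) (∈-++⁺ʳ V)) φ≈θ)) s ∷ all)

    after : ∀ A → ∃₂ (After A)
    after A with em {P = ∃[ φ ] (AgreeOn V θ₀ φ × B · φ ≡ A × Success A)}
    ... | no ¬answer = 0 , [] , λ θ₀≈θ eq s _ → contradiction (_ , θ₀≈θ , eq , s) ¬answer
    -- One representative `φ` of the answer suffices: any `θ` giving the same answer agrees with it
    -- on `V` and on the outputs of `B`, which is all that the rest depends on.
    ... | yes (φ , θ₀≈φ , refl , s)
      with k , Θ , f ← query-finite (V ++ outVars B) Bs φ wm (calls-rest θ₀≈φ s) =
      k , Θ , λ θ₀≈θ eq _ → f (agree-++ (agree-trans (agree-sym θ₀≈φ) θ₀≈θ)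
        (agree-⊆ (outVars⊆varsAtom B) (·-injective B (sym eq))))

    remaining : ∃₂ λ k Θ → ∀ {A} → A ∈ As → After A k Θ
    remaining = gather After after-mono after As

    k₂ = proj₁ remaining
    Θ  = proj₁ (proj₂ remaining)

    answered : ∀ {θ} → AgreeOn V θ₀ θ → All Ground ((B ∷ Bs) ·q θ) → Answered V (B ∷ Bs) (k₁ ⊔ k₂) Θ θ
    answered {θ} θ₀≈θ (gB ∷ gBs)
      with tB , answer ← first gB (agree⇒SameCall B (agree-⊆ inB θ₀≈θ))
      with em {P = Success (B · θ)}
    -- A failing `B` is itself the witness for (b), so nothing is needed about the later atoms.
    ... | no ¬s = ((λ { (s ∷ _) → contradiction s ¬s }) ,
                   (λ _ → here (¬s , terminates-≤ (m≤m⊔n k₁ k₂) tB))) ,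
                  λ { (s ∷ _) → contradiction s ¬s }
    ... | yes s with (success , failure) , answers ← proj₂ (proj₂ remaining) (answer s) θ₀≈θ refl s gBs =
      ((λ { (_ ∷ all) → terminates-≤ (m≤m⊔n k₁ k₂) tB ∷ All.map (terminates-≤ (m≤n⊔m k₁ k₂)) (success all) }) ,
       (λ ¬all → there (Any.map (λ (¬s , t) → ¬s , terminates-≤ (m≤n⊔m k₁ k₂) t)
                          (failure λ all → ¬all (s ∷ all))))) ,
      λ { (_ ∷ all) → Any.map (agree-⊆ (⊆-reflexive (sym (++-assoc V (outVars B) _)))) (answers all) }

  fairBoundedQuery : (∀ A → FinitelyCalled A) → ∀ Q → PermutationQuery WellModedQuery Q →
    FairBoundedQuery Q groundLevel groundSuccess
  fairBoundedQuery finite Q (Q′ , perm , wm)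
    -- No variable is bound at the start, so every instance agrees with `ε` on the empty list.
    with k , _ , f ← query-finite [] Q′ ε (fromWellModedBody Q′ wm) (λ _ B _ _ θ _ _ → finite (B · θ)) =
    suc k , λ As (θ , eq) → bounds As (subst (FairlyIn (Terminates k)) (sym eq)
      (fairlyIn-↭ (↭-map⁺ (_· θ) (↭-sym perm))
        (proj₁ (f (agree λ ()) (All-resp-↭ (↭-map⁺ (_· θ) perm) (subst (All Ground) eq (all-ground As)))))))

  -- A numerical rank for the dependency of predicates.

  reach : Rel → ℕ
  reach p = length (filter (λ c → em {P = DependsOn P p (rel (head c))}) P)

  reach-≤ : ∀ {p q} → DependsOn P p q → reach q ≤ reach p
  reach-≤ p⇝q = filter-length-≤ (λ _ → em) (λ _ → em) (p⇝q ◅◅_) P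

  -- The clause `c` counts for the predicate of its own head, by reflexivity of dependency, but not
  -- for `q`.
  reach-< : ∀ {c q} → c ∈ P → DependsOn P (rel (head c)) q → ¬ DependsOn P q (rel (head c)) →
    reach q < reach (rel (head c))
  reach-< c∈P p⇝q ¬q⇝p = filter-length-< (λ _ → em) (λ _ → em) (p⇝q ◅◅_) c∈P εˢ ¬q⇝p

  -- Finiteness of all calls, by acceptability.

  module _ (wmP : All (PermutationClause WellModedClause) P)
           (smP : All (PermutationClause SimplyModedClause) P)
           (lvl : ModedGeneralisedLevelMapping) (I : Pred Atom 0ℓ)
           (acceptable : SimplyAcceptable P lvl I) where
    open ModedGeneralisedLevelMapping lvl renaming (level to modedLevel)
    open SimplyAcceptable acceptable

    head⊆bound : ∀ {c} → c ∈ P → varsAtom (head c) ⊆ inVars (head c) ++ concatMap outVars (body c)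
    head⊆bound {c} c∈P with Cs , perm , _ , o ← wellModedHead (All.lookup wmP c∈P) =
      varsAtom⊆ (head c) ∈-++⁺ˡ
        (⊆-trans o (++⁺ʳ (inVars (head c)) (concatMap⁺ outVars (⊆-reflexive-↭ (↭-sym perm)))))

    body⊆bound : ∀ {c} → c ∈ P → ∀ {B} → B ∈ body c →
      varsAtom B ⊆ inVars (head c) ++ concatMap outVars (body c)
    body⊆bound {c} c∈P B∈ with Cs , perm , wm , _ ← wellModedHead (All.lookup wmP c∈P) =
      ⊆-trans (wellModed-vars Cs wm (∈-resp-↭ perm B∈))
        (++⁺ʳ (inVars (head c)) (concatMap⁺ outVars (⊆-reflexive-↭ (↭-sym perm))))

    groundOn-calls : ∀ V Cs θ → GroundOn V θ → All Ground (Cs ·q θ) → GroundOn (V ++ concatMap outVars Cs) θ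
    groundOn-calls V Cs θ gV gCs x x∈ with ∈-++⁻ V x∈
    ... | inj₁ x∈V = gV x x∈V
    ... | inj₂ x∈Cs with C , C∈ , x∈C ← find (∈-concatMap⁻ outVars x∈Cs) =
      Ground⇒GroundOn C θ (All.lookup (All.map⁻ gCs) C∈) x (outVars⊆varsAtom C x∈C)

    mutual
      -- `I` is closed only under simply-local instances. Well modedness places all variables of the
      -- clause among the head inputs and body outputs, so restricting `θ` to these is simply-local
      -- and changes neither head nor body.
      success⇒I : ∀ {A} → Success A → I A
      success⇒I (resolve {c} c∈P θ ground all) =
        subst I (·-cong (head c) (agree-⊆ (head⊆bound c∈P) (restrict-agree θ V)))
          (model c c∈P (restrict θ V)
            (simplyLocal-restrict c θ V ⊆-refl
              (groundOn-calls (inVars (head c)) (body c) θ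
                (λ x x∈ → Ground⇒GroundOn (head c) θ ground x (inVars⊆varsAtom (head c) x∈))
                (All.map success-ground all)))
            (all-success⇒I (body c) (λ B∈ → ·-cong _ (agree-⊆ (body⊆bound c∈P B∈) (restrict-agree θ V))) all))
        where V = inVars (head c) ++ concatMap outVars (body c)

      -- Stated by recursion on the list so that the mutual recursion follows the proof trees
      -- structurally.
      all-success⇒I : ∀ Bs {θ φ} → (∀ {B} → B ∈ Bs → B · φ ≡ B · θ) → All Success (Bs ·q θ) → All I (Bs ·q φ)
      all-success⇒I []       _  []        = []
      all-success⇒I (B ∷ Bs) eq (s ∷ all) =
        subst I (sym (eq (here refl))) (success⇒I s) ∷ all-success⇒I Bs (eq ∘ there) all

    measure : Atom → ℕ × ℕ
    measure A = reach (rel A) , modedLevel A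

    _≺_ : Atom → Atom → Set
    _≺_ = ×-Lex _≡_ _<_ _<_ on measure

    ≺-wellFounded : WellFounded _≺_
    ≺-wellFounded = On.wellFounded measure (×-wellFounded <-wellFounded <-wellFounded)

    modedLevel-cong : ∀ {A B} → SameCall A B → modedLevel A ≡ modedLevel B
    modedLevel-cong {atom p ts} {atom .p us} (refl , eq) = moded p ts us eq

    measure-cong : ∀ {A B} → SameCall A B → measure A ≡ measure B
    measure-cong A~B = cong₂ _,_ (cong reach (proj₁ A~B)) (modedLevel-cong A~B)

    -- Acceptability follows the textual order of the body, evaluation a well moded one. Leaving the
    -- outputs of B and of the atoms not yet evaluated unbound puts the latter in SM ⊆ I.
    call-decreases : ∀ {c} → c ∈ P → ∀ Cs B Ds → body c ↭ Cs ++ B ∷ Ds →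
      WellModedFrom (inVars (head c)) (Cs ++ B ∷ Ds) →
      ∀ θ → GroundOn (inVars (head c)) θ → All Success (Cs ·q θ) →
      MutuallyRecursive P (head c) B → modedLevel (B · θ) < modedLevel (head c · θ)
    call-decreases {c} c∈P Cs B Ds perm wm θ gHead all mutualRec
      with wmCs , inB , _ ← wellModed-++⁻ Cs wm
      with linear , disjoint , apart ← simpleBody-↭ perm (simplyModedClause⇒simpleBody c (All.lookup smP c∈P)) =
      -- The moded level sees only inputs, and on those of the head and of `B` the substitutions `φ`
      -- and `θ` agree.
      subst (modedLevel (B · θ) <_) (modedLevel-cong (agree⇒SameCall (head c) (agree-⊆ ∈-++⁺ˡ V≈)))
        (subst (_< modedLevel (head c · φ)) (modedLevel-cong (agree⇒SameCall B (agree-⊆ inB V≈)))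
          (subst (λ C → modedLevel (C · φ) < modedLevel (head c · φ)) (sym B≡)
            (decreases c c∈P φ local i
              (All.map⁺ (All.tabulate (inI ∘ take⊆ (toℕ i) (body c))))
              (subst (MutuallyRecursive P (head c)) B≡ mutualRec))))
      where
      V = inVars (head c) ++ concatMap outVars Cs
      φ = restrict θ V
      V≈ : AgreeOn V φ θ
      V≈ = restrict-agree θ V

      B∈ : B ∈ body c
      B∈ = ∈-resp-↭ (↭-sym perm) (∈-++⁺ʳ Cs (here refl))
      i  = index B∈
      B≡ : B ≡ lookup (body c) i
      B≡ = Any.lookup-index B∈

      Cs⊆body : Cs ⊆ body c
      Cs⊆body = ∈-resp-↭ (↭-sym perm) ∘ ∈-++⁺ˡ

      gV : GroundOn V θ
      gV = groundOn-calls (inVars (head c)) Cs θ gHead (All.map success-ground all)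

      local : SimplyLocal c φ
      local = simplyLocal-restrict c θ V
        (++⁺ʳ (inVars (head c)) (concatMap⁺ outVars Cs⊆body)) gV

      inI : ∀ {C} → C ∈ body c → I (C · φ)
      inI {C} C∈ with ∈-++⁻ Cs (∈-resp-↭ perm C∈)
      ... | inj₁ C∈Cs = subst I (sym (·-cong C (agree-⊆ (wellModed-vars Cs wmCs C∈Cs) V≈)))
                          (success⇒I (All.lookup (All.map⁻ all) C∈Cs))
      ... | inj₂ C∈Ds = containsSM _ (SM-restrict C θ V (All.lookup linear C∈′) (proj₂ (All.lookup apart C∈′))
                          out#V gV)
        where
        C∈′ : C ∈ Cs ++ B ∷ Ds
        C∈′ = ∈-++⁺ʳ Cs C∈Ds
        out#V : Disjoint (outVars C) V
        out#V (v∈C , v∈V) with ∈-++⁻ (inVars (head c)) v∈V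
        ... | inj₁ v∈in  = proj₁ (All.lookup apart C∈′) (v∈C , v∈in)
        ... | inj₂ v∈out with C′ , C′∈ , v∈C′ ← find (∈-concatMap⁻ outVars v∈out) =
          AllPairs-++⁻-cross Cs disjoint C′∈ C∈Ds (v∈C′ , v∈C)

    -- If the predicate of `B` depends back on that of the head, their ranks are equal and the moded
    -- level drops; otherwise the rank drops.
    call-≺ : ∀ {c} → c ∈ P → ∀ Cs B Ds → body c ↭ Cs ++ B ∷ Ds →
      WellModedFrom (inVars (head c)) (Cs ++ B ∷ Ds) →
      ∀ θ → GroundOn (inVars (head c)) θ → All Success (Cs ·q θ) → (B · θ) ≺ (head c · θ)
    call-≺ {c} c∈P Cs B Ds perm wm θ gHead all
      with H⇝B ← (c , c∈P , refl , B , ∈-resp-↭ (↭-sym perm) (∈-++⁺ʳ Cs (here refl)) , refl) ◅ εˢ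
      with em {P = DependsOn P (rel B) (rel (head c))}
    ... | yes B⇝H = inj₂ (≤-antisym (reach-≤ H⇝B) (reach-≤ B⇝H) ,
                          call-decreases c∈P Cs B Ds perm wm θ gHead all (H⇝B , B⇝H))
    ... | no ¬B⇝H = inj₁ (reach-< c∈P H⇝B ¬B⇝H)

    -- The contribution of a single clause to `FinitelyCalled`. Membership in `P` is a hypothesis
    -- inside it because `gather` asks for a bound for every clause.
    ViaClause : Atom → Clause → ℕ → List Atom → Set
    ViaClause A c k As = c ∈ P → ∀ θ → SameCall A (head c · θ) → Ground (head c · θ) →
      All Ground (body c ·q θ) →
      FairlyIn (Terminates k) (body c ·q θ) × (All Success (body c ·q θ) → head c · θ ∈ As)

    viaClause-mono : ∀ A {c k m As Bs} → k ≤ m → As ⊆ Bs → ViaClause A c k As → ViaClause A c m Bs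
    viaClause-mono A k≤m As⊆Bs f c∈P θ call gH gB with fair , answer ← f c∈P θ call gH gB =
      fairlyIn-map (terminates-≤ k≤m) fair , As⊆Bs ∘ answer

    body-callsFinite : ∀ A → (∀ {B} → B ≺ A → FinitelyCalled B) →
      ∀ {c θ₀} → c ∈ P → SameCall A (head c · θ₀) → Ground (head c · θ₀) →
      ∀ {Bs} → body c ↭ Bs → WellModedFrom (inVars (head c)) Bs → CallsFinite (inVars (head c)) θ₀ Bs
    body-callsFinite A ih {c} {θ₀} c∈P call₀ gH₀ perm wm Cs B Ds refl θ θ₀≈θ all =
      ih (subst (×-Lex _≡_ _<_ _<_ (measure (B · θ)))
            (measure-cong (SameCall-trans (agree⇒SameCall (head c) (agree-sym θ₀≈θ)) (SameCall-sym call₀)))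
            (call-≺ c∈P Cs B Ds perm wm θ
              (λ x x∈ → subst (λ t → varsTerm t ≡ []) (agrees θ₀≈θ x∈)
                (Ground⇒GroundOn (head c) θ₀ gH₀ x (inVars⊆varsAtom (head c) x∈))) all))

    -- All instances of the head that match the call agree on its input variables, so a single one,
    -- `θ₀`, can serve as the initial binding for the body. The variables of the head are bound by
    -- its inputs and the answers to the body, so each answer yields one success.
    viaClause : ∀ A → (∀ {B} → B ≺ A → FinitelyCalled B) → ∀ c → ∃₂ (ViaClause A c)
    viaClause A ih c
      with em {P = c ∈ P × ∃[ θ ] (SameCall A (head c · θ) × Ground (head c · θ))}
    ... | no ¬call = 0 , [] , λ c∈P θ call gH → contradiction (c∈P , θ , call , gH) ¬call
    ... | yes (c∈P , θ₀ , call₀ , gH₀)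
      with Bs , perm , wm , o ← wellModedHead (All.lookup wmP c∈P)
      with k , Θ , f ← query-finite (inVars (head c)) Bs θ₀ wm (body-callsFinite A ih c∈P call₀ gH₀ perm wm) =
      k , map (head c ·_) Θ , λ _ θ call gH gB →
        let θ₀≈θ = SameCall⇒agree (head c) (SameCall-trans (SameCall-sym call₀) call)
            fair , answer = f θ₀≈θ (All-resp-↭ (↭-map⁺ (_· θ) perm) gB)
        in fairlyIn-↭ (↭-map⁺ (_· θ) (↭-sym perm)) fair ,
           λ all → Any.map⁺ (Any.map (λ agreed → ·-cong (head c) (agree-⊆ (varsAtom⊆ (head c) ∈-++⁺ˡ o) agreed))
                     (answer (All-resp-↭ (↭-map⁺ (_· θ) perm) all)))

    finitelyCalled-step : ∀ A → (∀ {B} → B ≺ A → FinitelyCalled B) → FinitelyCalled A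
    finitelyCalled-step A ih
      with k , As , f ← gather (ViaClause A) (viaClause-mono A) (viaClause A ih) P =
      -- The extra one accounts for the resolution step from the call to the body.
      suc k , As , λ gB call →
        (λ { c∈P θ refl gBs → proj₁ (f c∈P c∈P θ call gB gBs) }) ,
        λ { (resolve c∈P θ gH all) → proj₂ (f c∈P c∈P θ call gH (All.map success-ground all)) all }

    finitelyCalled : ∀ A → FinitelyCalled A
    finitelyCalled = WF.All.wfRec ≺-wellFounded 0ℓ FinitelyCalled finitelyCalled-step

proposition9p5 : (∀ {ℓ} → ExcludedMiddle ℓ) →
    (L : Language) (mode : Moding L) →
    let open Programs L mode in
    ((P : Program) (Q : Query) →
    PermutationWellModed P → PermutationWellModedQuery Q →
    InputTerminate P Q → ∃-Terminate P Q)
    ×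
    ((P : Program) (Q : Query) →
    PermutationWellModed P → PermutationSimplyModed P →
    PermutationWellModedQuery Q → PermutationSimplyModedQuery Q →
    (lvl : ModedGeneralisedLevelMapping) (I : Pred Atom 0ℓ) →
    SimplyAcceptable P lvl I →
    ∃₂ λ (lvl′ : ExtendedLevelMapping) (J : HerbrandInterpretation) →
    FairBounded P lvl′ J × FairBoundedQuery Q lvl′ J)
proposition9p5 em L mode =
  (λ P Q wmP wmQ → InputTermination.∃-terminate em L mode P Q wmP wmQ) ,
  λ P Q wmP smP wmQ _ lvl I acceptable →
    let open FairBoundedness em L mode P in
    groundLevel , groundSuccess , fairBounded ,
    fairBoundedQuery (finitelyCalled wmP smP lvl I acceptable) Q wmQ
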